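{- Let $c>0$ be an integer constant and let $t(n)$ be a function. Any language recognized by a Turing machine (with a read-only input tape and a read-write work tape) that, on every input of length $n$, uses at most $\lfloor \log(n+2)\rfloor$ work tape cells, has a work tape alphabet of size at most $2^c$, and runs within $t(n)$ time, can also be recognized by a $(c+5)$-head finite automaton running within $$t(n)\cdot\Big(\big(2c+\tfrac{3}{2}\big)n+2c+2\Big)$$ time.
   Context: A $k$-head finite automaton is a finite-state machine with $k$ read-only heads moving on the input string $w$ written between a left end-marker $\rhd$ and a right end-marker $\lhd$ (the cell holding $\rhd$ has index $0$); all heads start on $\rhd$. In each step, depending on its current state and the $k$ scanned symbols, the machine enters a new state and moves each head one cell left, one cell right, or not at all. Computation halts when an accept or reject state is entered or a head moves beyond an end-marker. $\log$ denotes the base-$2$ logarithm and $n=|w|$. -}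

module Defs where

open import Data.Nat using (ℕ; zero; suc; _+_; _*_; _<_; _≤_; _<ᵇ_)
open import Data.Bool using (if_then_else_)
open import Data.Fin using (Fin; zero; suc)
open import Data.List using (List; []; _∷_; length)
open import Data.Maybe using (Maybe; just; nothing; _>>=_)
open import Data.Product using (Σ; ∃; _×_; _,_)
open import Data.Unit using (⊤)
open import Relation.Binary.PropositionalEquality using (_≡_)
open import Relation.Nullary using (¬_)

data Move : Set where
  left stay right : Move

data Sym (m : ℕ) : Set where
  ⊳ ⊲ : Sym m
  sym : Fin m → Sym m

data Status : Set where
  running accepting rejecting : Status

-- contents of the input tape  ⊳ w ⊲  at cell p (cell 0 holds ⊳,
-- cell |w|+1 holds ⊲; cells beyond are never reached)
tapeAt : ∀ {m} → List (Fin m) → ℕ → Sym m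
tapeAt w zero = ⊳
tapeAt [] (suc p) = ⊲
tapeAt (a ∷ w) (suc zero) = sym a
tapeAt (a ∷ w) (suc (suc p)) = tapeAt w (suc p)

-- move a head on the input tape whose last cell (⊲) is cell b;
-- nothing = the head moved beyond an end-marker
moveIn : ℕ → Move → ℕ → Maybe ℕ
moveIn b left zero = nothing
moveIn b left (suc p) = just p
moveIn b stay p = just p
moveIn b right p = if p <ᵇ b then just (suc p) else nothing

-- move the head on the (one-way infinite) work tape; moving left of
-- cell 0 halts the machine (without acceptance)
moveWork : Move → ℕ → Maybe ℕ
moveWork left zero = nothing
moveWork left (suc p) = just p
moveWork stay p = just p
moveWork right p = just (suc p)

record TM (m g : ℕ) : Set where
  field
    nstates : ℕ
    start   : Fin nstates
    status  : Fin nstates → Status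
    blank   : Fin g
    -- (state, input symbol, work symbol) ↦
    --   (new state, input head move, written work symbol, work head move)
    δ : Fin nstates → Sym m → Fin g → Fin nstates × Move × Fin g × Move

record TMConfig {m g : ℕ} (M : TM m g) : Set where
  constructor tmcfg
  field
    state   : Fin (TM.nstates M)
    inPos   : ℕ
    workPos : ℕ
    tape    : ℕ → Fin g

module _ {m g : ℕ} (M : TM m g) where
  open TM M
  open TMConfig

  private
    write : ℕ → Fin g → (ℕ → Fin g) → (ℕ → Fin g)
    write zero x f zero = x
    write zero x f (suc i) = f (suc i)
    write (suc p) x f zero = f zero
    write (suc p) x f (suc i) = write p x (λ j → f (suc j)) i

    stepRunning : List (Fin m) → TMConfig M → Maybe (TMConfig M)
    stepRunning w C with δ (state C) (tapeAt w (inPos C)) (tape C (workPos C))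
    ... | q' , di , x , dw =
      moveIn (suc (length w)) di (inPos C) >>= λ i' →
      moveWork dw (workPos C) >>= λ p' →
      just (tmcfg q' i' p' (write (workPos C) x (tape C)))

    stepBy : Status → List (Fin m) → TMConfig M → Maybe (TMConfig M)
    stepBy running w C = stepRunning w C
    stepBy accepting w C = just C
    stepBy rejecting w C = just C

  stepTM : List (Fin m) → TMConfig M → Maybe (TMConfig M)
  stepTM w C = stepBy (status (state C)) w C

  initTM : TMConfig M
  initTM = tmcfg start 0 0 (λ _ → blank)

  runTM : List (Fin m) → ℕ → Maybe (TMConfig M)
  runTM w zero = just initTM
  runTM w (suc i) = runTM w i >>= stepTM w

  HaltedTM : Maybe (TMConfig M) → Set
  HaltedTM nothing = ⊤
  HaltedTM (just C) = ¬ (status (state C) ≡ running)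

  AcceptsTM : List (Fin m) → Set
  AcceptsTM w = ∃ λ i → Σ (TMConfig M) λ C →
    runTM w i ≡ just C × status (state C) ≡ accepting

  RecognizesTM : (List (Fin m) → Set) → Set
  RecognizesTM P = ∀ w → (P w → AcceptsTM w) × (AcceptsTM w → P w)

  TimeBoundTM : (ℕ → ℕ) → Set
  TimeBoundTM t = ∀ w → ∃ λ i → i ≤ t (length w) × HaltedTM (runTM w i)

  -- on every input of length n, M uses at most s(n) work tape cells
  -- (cells 0 … s(n)-1), i.e. the work head never reaches cell s(n)
  SpaceBoundTM : (ℕ → ℕ) → Set
  SpaceBoundTM s = ∀ w i C → runTM w i ≡ just C → workPos C < s (length w)

record FA (k m : ℕ) : Set where
  field
    nstates : ℕ
    start   : Fin nstates
    status  : Fin nstates → Status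
    δ : Fin nstates → (Fin k → Sym m) → Fin nstates × (Fin k → Move)

record FAConfig {k m : ℕ} (A : FA k m) : Set where
  constructor facfg
  field
    state : Fin (FA.nstates A)
    pos   : Fin k → ℕ

allJust : ∀ {k} → (Fin k → Maybe ℕ) → Maybe (Fin k → ℕ)
allJust {zero} f = just (λ ())
allJust {suc k} f = f zero >>= λ x → allJust (λ i → f (suc i)) >>= λ g →
  just (λ { zero → x ; (suc i) → g i })

module _ {k m : ℕ} (A : FA k m) where
  open FA A
  open FAConfig

  private
    stepRunning : List (Fin m) → FAConfig A → Maybe (FAConfig A)
    stepRunning w C with δ (state C) (λ h → tapeAt w (pos C h))
    ... | q' , mv =
      allJust (λ h → moveIn (suc (length w)) (mv h) (pos C h)) >>= λ ps →
      just (facfg q' ps)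

    stepBy : Status → List (Fin m) → FAConfig A → Maybe (FAConfig A)
    stepBy running w C = stepRunning w C
    stepBy accepting w C = just C
    stepBy rejecting w C = just C

  stepFA : List (Fin m) → FAConfig A → Maybe (FAConfig A)
  stepFA w C = stepBy (status (state C)) w C

  initFA : FAConfig A
  initFA = facfg start (λ _ → 0)

  runFA : List (Fin m) → ℕ → Maybe (FAConfig A)
  runFA w zero = just initFA
  runFA w (suc i) = runFA w i >>= stepFA w

  HaltedFA : Maybe (FAConfig A) → Set
  HaltedFA nothing = ⊤
  HaltedFA (just C) = ¬ (status (state C) ≡ running)

  AcceptsFA : List (Fin m) → Set
  AcceptsFA w = ∃ λ i → Σ (FAConfig A) λ C →
    runFA w i ≡ just C × status (state C) ≡ accepting

  RecognizesFA : (List (Fin m) → Set) → Set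
  RecognizesFA P = ∀ w → (P w → AcceptsFA w) × (AcceptsFA w → P w)

  TimeBoundFA : (ℕ → ℕ) → Set
  TimeBoundFA t = ∀ w → ∃ λ i → i ≤ t (length w) × HaltedFA (runFA w i)

{-# OPTIONS --safe #-}
-- The automaton keeps the state of the Turing machine and work cells 0 and 1 in its finite control.
-- The remaining cells form c binary tracks: bit j of the position of track head k is bit k of the code
-- of the symbol in cell 2 + j.  A work head in cell 2 + p is stored as a head x at 2 ^ p - 1.
-- To read bit p of a track, its head counts down to 0 while x and a second head y exchange their
-- contents back and forth with period 2 ^ p; the parity of the number of exchanges is the bit.  A third
-- auxiliary head u remembers the count, so that the track can be restored.  Flipping bit p moves the
-- track head by 2 ^ p cells, and moving the work head doubles or halves 2 ^ p.
-- Since two cells are in the control, every track head stays below E with 4 E ≤ n + 2, so a step costs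
-- at most (7c + 3) E / 2 + 2, which is within the allowed (2c + 3/2) n + 2c + 2.
module Submission where

open import Defs
open import Data.Bool using (Bool; true; false; not; _xor_; if_then_else_)
open import Data.Bool.Properties using (not-involutive; xor-same; xor-identityʳ; not-distribˡ-xor; not-distribʳ-xor) renaming (_≟_ to _≟ᵇ_)
open import Data.Empty using (⊥-elim)
open import Data.Nat using (ℕ; zero; suc; _+_; _*_; _^_; _∸_; _<_; _≤_; _<ᵇ_; z≤n; s≤s; ⌊_/2⌋)
open import Data.Nat.DivMod using (_/_; m*n/n≡m; /-monoˡ-≤)
open import Data.Nat.Logarithm using (⌊log₂_⌋; ⌊log₂⌊n/2⌋⌋≡⌊log₂n⌋∸1)
open import Data.Nat.Properties
open import Data.Nat.Tactic.RingSolver using (solve-∀)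
open import Data.Fin as Fin using (Fin; zero; suc; splitAt; join; combine; remQuot; inject≤; inject₁; fromℕ; toℕ; finToFun; funToFin)
open import Data.Fin.Induction using (<-weakInduction)
open import Data.Fin.Properties using (any?; inject≤-injective; splitAt-join; remQuot-combine; funToFin-finToFin; toℕ-inject₁; toℕ-fromℕ; toℕ-injective; toℕ≤pred[n])
open import Data.List using (List; []; _∷_; length)
open import Data.Maybe using (Maybe; just; nothing; _>>=_)
open import Data.Product using (Σ; ∃; _×_; _,_; proj₁; proj₂)
open import Data.Sum using (_⊎_; inj₁; inj₂) renaming (map to ⊎-map)
open import Data.Unit using (⊤; tt)
open import Data.Vec using (Vec; []; _∷_; lookup; map; replicate; tabulate; zipWith; _[_]≔_)
open import Data.Vec.Properties using (lookup∘tabulate; tabulate∘lookup; tabulate-cong; ≡-dec; []≔-lookup; []≔-idempotent; lookup∘update; lookup∘update′; lookup-map; lookup-zipWith; lookup-replicate; map-replicate)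
open import Relation.Binary.PropositionalEquality renaming (sym to ≡-sym)
open import Relation.Nullary using (yes; no; does)

-- Bits of natural numbers

odd : ℕ → Bool
odd zero = false
odd (suc n) = not (odd n)

bit : ℕ → ℕ → Bool
bit zero N = odd N
bit (suc p) N = bit p ⌊ N /2⌋

toℕᵇ : Bool → ℕ
toℕᵇ false = 0
toℕᵇ true = 1

setBit : ℕ → Bool → ℕ → ℕ
setBit zero b N = 2 * ⌊ N /2⌋ + toℕᵇ b
setBit (suc p) b N = 2 * setBit p b ⌊ N /2⌋ + toℕᵇ (odd N)

private
  2*suc : ∀ k M → 2 * suc k + M ≡ suc (suc (2 * k + M))
  2*suc k M = cong (λ j → suc (j + M)) (+-suc k (k + 0))

odd-double-+ : ∀ k M → odd (2 * k + M) ≡ odd M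
odd-double-+ zero M = refl
odd-double-+ (suc k) M = trans (cong odd (2*suc k M))
  (trans (not-involutive _) (odd-double-+ k M))

half-double-+ : ∀ k M → ⌊ 2 * k + M /2⌋ ≡ k + ⌊ M /2⌋
half-double-+ zero M = refl
half-double-+ (suc k) M = trans (cong ⌊_/2⌋ (2*suc k M)) (cong suc (half-double-+ k M))

odd-double-toℕᵇ : ∀ k b → odd (2 * k + toℕᵇ b) ≡ b
odd-double-toℕᵇ k false = odd-double-+ k 0
odd-double-toℕᵇ k true = odd-double-+ k 1

half-double-toℕᵇ : ∀ k b → ⌊ 2 * k + toℕᵇ b /2⌋ ≡ k
half-double-toℕᵇ k false = trans (half-double-+ k 0) (+-identityʳ k)
half-double-toℕᵇ k true = trans (half-double-+ k 1) (+-identityʳ k)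

double-half-odd : ∀ N → 2 * ⌊ N /2⌋ + toℕᵇ (odd N) ≡ N
double-half-odd zero = refl
double-half-odd (suc zero) = refl
double-half-odd (suc (suc N)) with odd N | double-half-odd N
... | true | e = trans (2*suc ⌊ N /2⌋ 1) (cong (λ j → suc (suc j)) e)
... | false | e = trans (2*suc ⌊ N /2⌋ 0) (cong (λ j → suc (suc j)) e)

half-< : ∀ {N k} → N < 2 * k → ⌊ N /2⌋ < k
half-< {N} {k} lt = *-cancelˡ-< 2 _ _
  (≤-<-trans (subst (2 * ⌊ N /2⌋ ≤_) (double-half-odd N) (m≤m+n _ _)) lt)

double-toℕᵇ-< : ∀ {k l} b → k < l → 2 * k + toℕᵇ b < 2 * l
double-toℕᵇ-< {k} {l} b lt = ≤-trans (s≤s (+-monoʳ-≤ (2 * k) (toℕᵇ≤1 b)))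
  (subst (_≤ 2 * l) (trans (*-suc 2 k) (trans (+-comm 2 (2 * k)) (+-suc (2 * k) 1))) (*-monoʳ-≤ 2 lt))
  where
  toℕᵇ≤1 : ∀ b → toℕᵇ b ≤ 1
  toℕᵇ≤1 false = z≤n
  toℕᵇ≤1 true = s≤s z≤n

-- Halving turns 2 ^ suc p into 2 ^ p, and at the bottom adding 1 flips the parity. In reading a
-- track, this accounts for one exchange of `x` and `y`.
bit-+-2^ : ∀ p M → bit p (2 ^ p + M) ≡ not (bit p M)
bit-+-2^ zero M = refl
bit-+-2^ (suc p) M rewrite half-double-+ (2 ^ p) M = bit-+-2^ p ⌊ M /2⌋

bit-<-2^ : ∀ p {N} → N < 2 ^ p → bit p N ≡ false
bit-<-2^ zero (s≤s z≤n) = refl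
bit-<-2^ (suc p) lt = bit-<-2^ p (half-< lt)

bit-0 : ∀ p → bit p 0 ≡ false
bit-0 zero = refl
bit-0 (suc p) = bit-0 p

bit-setBit : ∀ p b N → bit p (setBit p b N) ≡ b
bit-setBit zero b N = odd-double-toℕᵇ ⌊ N /2⌋ b
bit-setBit (suc p) b N rewrite half-double-toℕᵇ (setBit p b ⌊ N /2⌋) (odd N) =
  bit-setBit p b ⌊ N /2⌋

bit-setBit-≢ : ∀ {j} p b N → j ≢ p → bit j (setBit p b N) ≡ bit j N
bit-setBit-≢ {zero} zero b N j≢p = ⊥-elim (j≢p refl)
bit-setBit-≢ {suc j} zero b N j≢p = cong (bit j) (half-double-toℕᵇ ⌊ N /2⌋ b)
bit-setBit-≢ {zero} (suc p) b N j≢p = odd-double-toℕᵇ (setBit p b ⌊ N /2⌋) (odd N)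
bit-setBit-≢ {suc j} (suc p) b N j≢p
  rewrite half-double-toℕᵇ (setBit p b ⌊ N /2⌋) (odd N) =
  bit-setBit-≢ p b ⌊ N /2⌋ (λ e → j≢p (cong suc e))

setBit-< : ∀ {p S} b {N} → p < S → N < 2 ^ S → setBit p b N < 2 ^ S
setBit-< {zero} {suc S} b _ lt = double-toℕᵇ-< {l = 2 ^ S} b (half-< lt)
setBit-< {suc p} {suc S} b {N} (s≤s p<S) lt =
  double-toℕᵇ-< {l = 2 ^ S} (odd N) (setBit-< b p<S (half-< lt))

-- The move that a head at N makes 2 ^ p times to reach setBit p b′ N, when bit p N is b.
bitMove : Bool → Bool → Move
bitMove false true = right
bitMove true false = left
bitMove _ _ = stay

-- `k` moves in the given direction lead from `N` to `N′`; the equations are additive so that no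
-- truncated subtraction enters.
Shift : Move → ℕ → ℕ → ℕ → Set
Shift left k N N′ = N ≡ k + N′
Shift stay k N N′ = N ≡ N′
Shift right k N N′ = k + N ≡ N′

private
  shift-double : ∀ μ k {h h′} r → Shift μ k h h′ → Shift μ (2 * k) (2 * h + r) (2 * h′ + r)
  shift-double left k {h′ = h′} r refl =
    trans (cong (_+ r) (*-distribˡ-+ 2 k h′)) (+-assoc (2 * k) (2 * h′) r)
  shift-double stay k r refl = refl
  shift-double right k {h} r refl =
    ≡-sym (trans (cong (_+ r) (*-distribˡ-+ 2 k h)) (+-assoc (2 * k) (2 * h) r))

  shift-parity : ∀ h b b′ → Shift (bitMove b b′) 1 (2 * h + toℕᵇ b) (2 * h + toℕᵇ b′)
  shift-parity h false false = refl
  shift-parity h false true = ≡-sym (+-suc (2 * h) 0)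
  shift-parity h true false = +-suc (2 * h) 0
  shift-parity h true true = refl

-- At bit 0 only the parity changes. A change of bit `p` in the half, a distance of 2 ^ p, doubles
-- in the number itself, and the parity is carried along.
shift-setBit : ∀ p b N → Shift (bitMove (bit p N) b) (2 ^ p) N (setBit p b N)
shift-setBit zero b N =
  subst (λ n → Shift (bitMove (odd N) b) 1 n (2 * ⌊ N /2⌋ + toℕᵇ b)) (double-half-odd N)
    (shift-parity ⌊ N /2⌋ (odd N) b)
shift-setBit (suc p) b N =
  subst (λ n → Shift (bitMove (bit p ⌊ N /2⌋) b) (2 ^ suc p) n (setBit (suc p) b N))
    (double-half-odd N)
    (shift-double (bitMove (bit p ⌊ N /2⌋) b) (2 ^ p) (toℕᵇ (odd N)) (shift-setBit p b ⌊ N /2⌋))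

moveIn-right : ∀ {B p} → p < B → moveIn B right p ≡ just (suc p)
moveIn-right {B} {p} lt with p <ᵇ B | <⇒<ᵇ lt
... | true | _ = refl

-- A bound on the final position is enough: a head moving right stays at or below it on the way, and
-- a head moving left still has `suc k` cells to its left.
shift-step : ∀ {B} μ k {N N′} → N′ ≤ B → Shift μ (suc k) N N′ →
  ∃ λ N₁ → moveIn B μ N ≡ just N₁ × Shift μ k N₁ N′
shift-step left k le refl = _ , refl , refl
shift-step stay k le refl = _ , refl , refl
shift-step right k {N} le refl =
  suc N , moveIn-right (≤-trans (s≤s (m≤n+m N k)) le) , +-suc k N

shift-0 : ∀ μ {N N′} → Shift μ 0 N N′ → N ≡ N′
shift-0 left e = e
shift-0 stay e = e
shift-0 right e = e

2^⌊log₂⌋≤ : ∀ n → 2 ^ ⌊log₂ suc n ⌋ ≤ suc n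
2^⌊log₂⌋≤ n = go ⌊log₂ suc n ⌋ n refl
  -- The recursion is on the value of the logarithm, which drops by one when the argument is halved.
  where
  go : ∀ k n → ⌊log₂ suc n ⌋ ≡ k → 2 ^ k ≤ suc n
  go zero n _ = s≤s z≤n
  go (suc k) zero ()
  go (suc k) (suc n) e = begin
    2 * 2 ^ k
      ≤⟨ *-monoʳ-≤ 2 (go k ⌊ n /2⌋ (trans (⌊log₂⌊n/2⌋⌋≡⌊log₂n⌋∸1 (suc (suc n))) (cong (_∸ 1) e))) ⟩
    2 * ⌊ suc (suc n) /2⌋ ≤⟨ m≤m+n _ _ ⟩
    2 * ⌊ suc (suc n) /2⌋ + toℕᵇ (odd (suc (suc n))) ≡⟨ double-half-odd (suc (suc n)) ⟩
    suc (suc n) ∎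
    where open ≤-Reasoning

lookup-ext : ∀ {A : Set} {n} {xs ys : Vec A n} → (∀ i → lookup xs i ≡ lookup ys i) → xs ≡ ys
lookup-ext {xs = xs} {ys} e =
  trans (≡-sym (tabulate∘lookup xs)) (trans (tabulate-cong e) (tabulate∘lookup ys))

-- Finite types

-- Only a left inverse of the numbering is recorded: the automaton visits no states other than those
-- of the form `index a`.
record Finite (A : Set) : Set where
  field
    size : ℕ
    index : A → Fin size
    element : Fin size → A
    element-index : ∀ a → element (index a) ≡ a

open Finite

retract : ∀ {A B : Set} (f : A → B) (g : B → A) → (∀ a → g (f a) ≡ a) → Finite B → Finite A
retract f g gf F = record
  { size = size F
  ; index = λ a → index F (f a)
  ; element = λ i → g (element F i)
  ; element-index = λ a → trans (cong g (element-index F (f a))) (gf a)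
  }

finFinite : ∀ n → Finite (Fin n)
finFinite n = record { size = n ; index = λ i → i ; element = λ i → i ; element-index = λ _ → refl }

infixr 3 _⊎ᶠ_
infixr 4 _×ᶠ_

_⊎ᶠ_ : ∀ {A B : Set} → Finite A → Finite B → Finite (A ⊎ B)
F ⊎ᶠ G = record
  { size = size F + size G
  ; index = λ s → join (size F) (size G) (⊎-map (index F) (index G) s)
  ; element = λ i → ⊎-map (element F) (element G) (splitAt (size F) i)
  ; element-index = λ s → trans
      (cong (⊎-map (element F) (element G)) (splitAt-join (size F) (size G) (⊎-map (index F) (index G) s))) (inv s)
  }
  where
  inv : ∀ s → ⊎-map (element F) (element G) (⊎-map (index F) (index G) s) ≡ s
  inv (inj₁ a) = cong inj₁ (element-index F a)
  inv (inj₂ b) = cong inj₂ (element-index G b)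

_×ᶠ_ : ∀ {A B : Set} → Finite A → Finite B → Finite (A × B)
F ×ᶠ G = record
  { size = size F * size G
  ; index = λ (a , b) → combine (index F a) (index G b)
  ; element = λ i → let (j , k) = remQuot (size G) i in element F j , element G k
  ; element-index = λ (a , b) → trans
      (cong (λ (j , k) → element F j , element G k) (remQuot-combine (index F a) (index G b)))
      (cong₂ _,_ (element-index F a) (element-index G b))
  }

⊤ᶠ : Finite ⊤
⊤ᶠ = retract (λ _ → zero) (λ _ → tt) (λ _ → refl) (finFinite 1)

boolFinite : Finite Bool
boolFinite = retract (λ { false → inj₁ tt ; true → inj₂ tt }) (λ { (inj₁ _) → false ; (inj₂ _) → true })
  (λ { false → refl ; true → refl }) (⊤ᶠ ⊎ᶠ ⊤ᶠ)

moveFinite : Finite Move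
moveFinite = retract
  (λ { left → inj₁ tt ; stay → inj₂ (inj₁ tt) ; right → inj₂ (inj₂ tt) })
  (λ { (inj₁ _) → left ; (inj₂ (inj₁ _)) → stay ; (inj₂ (inj₂ _)) → right })
  (λ { left → refl ; stay → refl ; right → refl }) (⊤ᶠ ⊎ᶠ ⊤ᶠ ⊎ᶠ ⊤ᶠ)

vecFinite : ∀ {A : Set} → Finite A → ∀ n → Finite (Vec A n)
vecFinite F zero = retract (λ _ → tt) (λ _ → []) (λ { [] → refl }) ⊤ᶠ
vecFinite F (suc n) = retract (λ { (x ∷ xs) → x , xs }) (λ (x , xs) → x ∷ xs)
  (λ { (_ ∷ _) → refl }) (F ×ᶠ vecFinite F n)

-- Work symbols as bit vectors

module SymbolCode {g c : ℕ} (g≤2^c : g ≤ 2 ^ c) (blank : Fin g) where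

  private
    fromFin2 : Fin 2 → Bool
    fromFin2 zero = false
    fromFin2 (suc zero) = true

    fromFin2-injective : ∀ i j → fromFin2 i ≡ fromFin2 j → i ≡ j
    fromFin2-injective zero zero _ = refl
    fromFin2-injective (suc zero) (suc zero) _ = refl
    fromFin2-injective zero (suc zero) ()
    fromFin2-injective (suc zero) zero ()

    xor-cancelʳ : ∀ r a b → a xor r ≡ b xor r → a ≡ b
    xor-cancelʳ r false false _ = refl
    xor-cancelʳ r true true _ = refl
    xor-cancelʳ false false true ()
    xor-cancelʳ true false true ()
    xor-cancelʳ false true false ()
    xor-cancelʳ true true false ()

    digits : Fin g → Fin c → Bool
    digits x i = fromFin2 (finToFun (inject≤ x g≤2^c) i)

  -- Masking with the digits of the blank gives the blank the all-zero code.
  encode : Fin g → Vec Bool c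
  encode x = tabulate λ i → digits x i xor digits blank i

  private
    lookup-encode : ∀ x i → lookup (encode x) i ≡ digits x i xor digits blank i
    lookup-encode x = lookup∘tabulate λ i → digits x i xor digits blank i

    funToFin-cong : ∀ {k l} (f h : Fin k → Fin l) → (∀ i → f i ≡ h i) → funToFin f ≡ funToFin h
    funToFin-cong {zero} f h e = refl
    funToFin-cong {suc k} f h e =
      cong₂ combine (e zero) (funToFin-cong (λ i → f (suc i)) (λ i → h (suc i)) (λ i → e (suc i)))

  -- Xor with a fixed mask can be cancelled, and the binary digits determine the symbol.
  encode-injective : ∀ x y → encode x ≡ encode y → x ≡ y
  encode-injective x y e = inject≤-injective g≤2^c g≤2^c x y
    (trans (≡-sym (funToFin-finToFin {c} (inject≤ x g≤2^c)))
      (trans (funToFin-cong _ _ λ i → fromFin2-injective _ _ (xor-cancelʳ (digits blank i) _ _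
               (trans (≡-sym (lookup-encode x i)) (trans (cong (λ v → lookup v i) e) (lookup-encode y i)))))
        (funToFin-finToFin {c} (inject≤ y g≤2^c))))

  decode : Vec Bool c → Fin g
  decode v with any? (λ x → ≡-dec _≟ᵇ_ (encode x) v)
  ... | yes (x , _) = x
  -- A default value for vectors that encode no symbol.
  ... | no _ = blank

  decode-encode : ∀ x → decode (encode x) ≡ x
  decode-encode x with any? (λ y → ≡-dec _≟ᵇ_ (encode y) (encode x))
  ... | yes (y , e) = encode-injective y x e
  ... | no ∄ = ⊥-elim (∄ (x , refl))

  -- Hence track heads that all rest on cell 0 represent a blank tape, as at the start of a run.
  decode-replicate-false : decode (replicate c false) ≡ blank
  decode-replicate-false = trans (cong decode (≡-sym encode-blank)) (decode-encode blank)
    where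
    encode-blank : encode blank ≡ replicate c false
    encode-blank = lookup-ext λ i → trans (lookup-encode blank i)
      (trans (xor-same (digits blank i)) (≡-sym (lookup-replicate i false)))

-- Runs of partial step functions that stop at halting configurations

-- Leaving the tape halts without acceptance and so counts as rejecting. Both machines can then be
-- compared by one status, halting being a status other than `running`.
outcome : ∀ {S : Set} → (S → Status) → Maybe S → Status
outcome st nothing = rejecting
outcome st (just s) = st s

module Runs {S : Set} (st : S → Status) (step : S → Maybe S)
            (halted-step : ∀ s → st s ≢ running → step s ≡ just s)
            (run : ℕ → Maybe S) (run-suc : ∀ i → run (suc i) ≡ (run i >>= step)) where

  halted-run : ∀ i k → outcome st (run i) ≢ running → run (k + i) ≡ run i
  halted-run i zero h = refl
  halted-run i (suc k) h =
    trans (run-suc (k + i)) (trans (cong (_>>= step) (halted-run i k h)) (fixed (run i) h))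
    where
    fixed : ∀ r → outcome st r ≢ running → (r >>= step) ≡ r
    fixed nothing _ = refl
    fixed (just s) h = halted-step s h

  -- A halted run no longer changes, so the earlier of the two times already shows the result at the
  -- later one.
  outcome-unique : ∀ i j → outcome st (run i) ≢ running → outcome st (run j) ≢ running →
    outcome st (run i) ≡ outcome st (run j)
  outcome-unique i j hi hj with ≤-total i j
  ... | inj₁ i≤j = cong (outcome st)
    (trans (≡-sym (halted-run i (j ∸ i) hi)) (cong run (m∸n+n≡m i≤j)))
  ... | inj₂ j≤i = cong (outcome st)
    (trans (cong run (≡-sym (m∸n+n≡m j≤i))) (halted-run j (i ∸ j) hj))

-- Multi-head automata

isLeftEnd : ∀ {m} → Sym m → Bool
isLeftEnd ⊳ = true
isLeftEnd ⊲ = false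
isLeftEnd (sym _) = false

isZero : ℕ → Bool
isZero zero = true
isZero (suc _) = false

isLeftEnd-tapeAt : ∀ {m} (w : List (Fin m)) p → isLeftEnd (tapeAt w p) ≡ isZero p
isLeftEnd-tapeAt w zero = refl
isLeftEnd-tapeAt [] (suc p) = refl
isLeftEnd-tapeAt (a ∷ w) (suc zero) = refl
isLeftEnd-tapeAt (a ∷ w) (suc (suc p)) = isLeftEnd-tapeAt w (suc p)

allJust-just : ∀ {k} (f : Fin k → Maybe ℕ) (g : Fin k → ℕ) → (∀ i → f i ≡ just (g i)) →
  ∃ λ h → allJust f ≡ just h × (∀ i → h i ≡ g i)
allJust-just {zero} f g e = _ , refl , λ ()
allJust-just {suc k} f g e
  with f zero | e zero | allJust (λ i → f (suc i))
     | allJust-just (λ i → f (suc i)) (λ i → g (suc i)) (λ i → e (suc i))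
... | _ | refl | _ | h , refl , hg = _ , refl , λ { zero → refl ; (suc i) → hg i }

allJust-nothing : ∀ {k} (f : Fin k → Maybe ℕ) i → f i ≡ nothing → allJust f ≡ nothing
allJust-nothing f zero e rewrite e = refl
allJust-nothing f (suc i) e with f zero
... | nothing = refl
... | just _ rewrite allJust-nothing (λ j → f (suc j)) i e = refl

module _ {k m : ℕ} (A : FA k m) (w : List (Fin m)) where

  private
    B : ℕ
    B = suc (length w)

  stepFA-just : ∀ {q q′ mv ps} (ps′ : Fin k → ℕ) → FA.status A q ≡ running →
    FA.δ A q (λ h → tapeAt w (ps h)) ≡ (q′ , mv) →
    (∀ h → moveIn B (mv h) (ps h) ≡ just (ps′ h)) →
    ∃ λ ps″ → stepFA A w (facfg q ps) ≡ just (facfg q′ ps″) × (∀ h → ps″ h ≡ ps′ h)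
  stepFA-just {q} {mv = mv} {ps} ps′ run e moves
    with allJust-just (λ h → moveIn B (mv h) (ps h)) ps′ moves
  ... | h , e′ , hg rewrite run | e | e′ = h , refl , hg

  stepFA-nothing : ∀ {q q′ mv ps} h → FA.status A q ≡ running →
    FA.δ A q (λ h → tapeAt w (ps h)) ≡ (q′ , mv) →
    moveIn B (mv h) (ps h) ≡ nothing → stepFA A w (facfg q ps) ≡ nothing
  stepFA-nothing {q} {mv = mv} {ps} h run e move
    rewrite run | e | allJust-nothing (λ h → moveIn B (mv h) (ps h)) h move = refl

  stepFA-halted : ∀ C → FA.status A (FAConfig.state C) ≢ running → stepFA A w C ≡ just C
  stepFA-halted C h with FA.status A (FAConfig.state C)
  ... | running = ⊥-elim (h refl)
  ... | accepting = refl
  ... | rejecting = refl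

-- Turing machines

-- writeTape names the tape update of stepTM, which Defs keeps private; the placeholder is solved by
-- the unification in stepTM-running.
mutual
  writeTape : ∀ {m g} (M : TM m g) → ℕ → Fin g → (ℕ → Fin g) → ℕ → Fin g
  writeTape M = _

  stepTM-running : ∀ {m g} (M : TM m g) (w : List (Fin m)) q i p f {q′ di x dw} →
    TM.status M q ≡ running → TM.δ M q (tapeAt w i) (f p) ≡ (q′ , di , x , dw) →
    stepTM M w (tmcfg q i p f) ≡
      (moveIn (suc (length w)) di i >>= λ i′ → moveWork dw p >>= λ p′ →
       just (tmcfg q′ i′ p′ (writeTape M p x f)))
  stepTM-running M w q i p f e₁ e₂ rewrite e₁ | e₂ = refl

module _ {m g : ℕ} (M : TM m g) where

  writeTape-≡ : ∀ p x f → writeTape M p x f p ≡ x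
  writeTape-≡ zero x f = refl
  writeTape-≡ (suc p) x f = writeTape-≡ p x (λ j → f (suc j))

  writeTape-≢ : ∀ {j} p x f → j ≢ p → writeTape M p x f j ≡ f j
  writeTape-≢ {zero} zero x f j≢p = ⊥-elim (j≢p refl)
  writeTape-≢ {suc j} zero x f j≢p = refl
  writeTape-≢ {zero} (suc p) x f j≢p = refl
  writeTape-≢ {suc j} (suc p) x f j≢p = writeTape-≢ p x (λ j → f (suc j)) (λ e → j≢p (cong suc e))

  stepTM-halted : ∀ w C → TM.status M (TMConfig.state C) ≢ running → stepTM M w C ≡ just C
  stepTM-halted w C h with TM.status M (TMConfig.state C)
  ... | running = ⊥-elim (h refl)
  ... | accepting = refl
  ... | rejecting = refl

-- Control states and transitions of the simulating machine

-- The number 2 ^ p - 1 without subtraction; doubling and adding 1, the effect of a work move to the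
-- right, is its defining equation.
mersenne : ℕ → ℕ
mersenne zero = 0
mersenne (suc p) = suc (mersenne p + mersenne p)

suc-mersenne : ∀ p → suc (mersenne p) ≡ 2 ^ p
suc-mersenne zero = refl
suc-mersenne (suc p) = trans (cong suc (≡-sym (+-suc (mersenne p) (mersenne p))))
  (cong₂ _+_ (suc-mersenne p) (trans (suc-mersenne p) (≡-sym (+-identityʳ (2 ^ p)))))

-- One field `track` suffices because in each step at most the current track moves.
record Moves : Set where
  constructor moves
  field
    input x y u track : Move

module Machine {c′ m g : ℕ} (M : TM m g) (g≤2^c : g ≤ 2 ^ suc c′) where

  open TM M
  open SymbolCode {c = suc c′} g≤2^c blank

  c : ℕ
  c = suc c′

  Control : Set
  Control = Fin nstates × Fin g × Fin g

  -- What has just been done, and so what comes next, when `draining` has emptied `y` and `u`.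
  data Phase : Set where
    read : Vec Bool c → Fin c → Phase
    write : Move → Vec Bool c → Vec Bool c → Fin c → Phase
    move : Phase

  -- In near, the Boolean tells which of the cells 0 (false) and 1 (true) the work head is on.
  data State : Set where
    near : Control → Bool → State
    far : Control → State
    dead : State
    reading : Control → Vec Bool c → Fin c → Bool → State
    writing : Control → Move → Vec Bool c → Vec Bool c → Fin c → State
    doubling : Control → State
    halvingOdd : Control → State
    halvingEven : Control → State
    draining : Control → Phase → State

  statusOf : State → Status
  statusOf (near (q , _) _) = status q
  statusOf (far (q , _)) = status q
  statusOf dead = rejecting
  statusOf _ = running

  phaseTrack : Phase → Fin c
  phaseTrack (read _ j) = j
  phaseTrack (write _ _ _ j) = j
  phaseTrack move = zero

  -- In the states that handle no track, `zero` is a default; there the track move is always `stay`.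
  currentTrack : State → Fin c
  currentTrack (reading _ _ j _) = j
  currentTrack (writing _ _ _ _ j) = j
  currentTrack (draining _ k) = phaseTrack k
  currentTrack _ = zero

  still : Moves
  still = moves stay stay stay stay stay

  nearFirst : Fin g → Fin nstates × Move × Fin g × Move → State × Moves
  -- Leaving the work tape on the left halts the Turing machine without acceptance; `dead` imitates
  -- this by rejecting.
  nearFirst b (q , di , s , left) = dead , still
  nearFirst b (q , di , s , stay) = near (q , s , b) false , moves di stay stay stay stay
  nearFirst b (q , di , s , right) = near (q , s , b) true , moves di stay stay stay stay

  nearSecond : Fin g → Fin nstates × Move × Fin g × Move → State × Moves
  nearSecond a (q , di , s , left) = near (q , a , s) false , moves di stay stay stay stay
  nearSecond a (q , di , s , stay) = near (q , a , s) true , moves di stay stay stay stay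
  nearSecond a (q , di , s , right) = far (q , a , s) , moves di stay stay stay stay

  startWriting : Fin g → Fin g → Vec Bool c → Fin nstates × Move × Fin g × Move → State × Moves
  startWriting a b old (q , di , s , dw) =
    writing (q , a , b) dw old (encode s) (fromℕ c′) , moves di stay stay stay stay

  startMoving : Control → Move → State
  startMoving ctl left = halvingOdd ctl
  startMoving ctl stay = far ctl
  startMoving ctl right = doubling ctl

  -- After a read, `u` holds the count that restores the track; in a work move it holds a part of
  -- the new value of `x`.
  pour : Phase → Moves
  pour move = moves stay right stay left stay
  pour _ = moves stay stay stay left right

  next : Control → Phase → Sym m → State × Moves
  next ctl (read bs (suc j)) s = reading ctl bs (inject₁ j) false , still
  next (q , a , b) (read bs zero) s = startWriting a b bs (δ q s (decode bs))
  next ctl (write dw old new (suc j)) s = writing ctl dw old new (inject₁ j) , still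
  next ctl (write dw old new zero) s = startMoving ctl dw , still
  next ctl move s = far ctl , still

  -- The Booleans tell whether the heads x, y, u and the current track are on the left end-marker.
  transition : State → Sym m → (x y u t : Bool) → State × Moves
  transition (near (q , a , b) false) s _ _ _ _ = nearFirst b (δ q s a)
  transition (near (q , a , b) true) s _ _ _ _ = nearSecond a (δ q s b)
  transition (far ctl) _ _ _ _ _ = reading ctl (replicate c false) (fromℕ c′) false , still
  transition dead _ _ _ _ _ = dead , still
  transition (reading ctl bs j tog) _ _ _ _ true = draining ctl (read (bs [ j ]≔ tog) j) , still
  transition (reading ctl bs j false) _ false _ _ false =
    reading ctl bs j false , moves stay left right right left
  -- The turn takes a step of its own, in which `x` and `y` rest while the track and `u` go on. This
  -- makes the period 2 ^ p rather than 2 ^ p - 1.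
  transition (reading ctl bs j false) _ true _ _ false =
    reading ctl bs j true , moves stay stay stay right left
  transition (reading ctl bs j true) _ _ false _ false =
    reading ctl bs j true , moves stay right left right left
  transition (reading ctl bs j true) _ _ true _ false =
    reading ctl bs j false , moves stay stay stay right left
  transition (writing ctl dw old new j) _ false _ _ _ =
    writing ctl dw old new j , moves stay left right stay (bitMove (lookup old j) (lookup new j))
  -- The track moves once more when `x` is already at 0: after 2 ^ p - 1 moves this is the last of 2
  -- ^ p.
  transition (writing ctl dw old new j) _ true _ _ _ =
    draining ctl (write dw old new j) , moves stay stay stay stay (bitMove (lookup old j) (lookup new j))
  transition (doubling ctl) _ false _ _ _ = doubling ctl , moves stay left right right stay
  -- The value d of `x` now stands in both `y` and `u`. The one step of `x` to the right makes the
  -- sum 2 d + 1 after both are poured back.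
  transition (doubling ctl) _ true _ _ _ = draining ctl move , moves stay right stay stay stay
  transition (halvingOdd ctl) _ false _ _ _ = halvingEven ctl , moves stay left stay stay stay
  -- Here `x` started at 2 ^ 0 - 1, so the work head goes from cell 2 to cell 1, which the control
  -- holds.
  transition (halvingOdd ctl) _ true _ _ _ = near ctl true , still
  transition (halvingEven ctl) _ false _ _ _ = halvingOdd ctl , moves stay left stay right stay
  transition (halvingEven ctl) _ true _ _ _ = draining ctl move , still
  transition (draining ctl k) _ _ false _ _ = draining ctl k , moves stay right left stay stay
  transition (draining ctl k) _ _ true false _ = draining ctl k , pour k
  transition (draining ctl k) s _ true true _ = next ctl k s

  record Conf : Set where
    constructor conf
    field
      state : State
      inp x y u : ℕ
      tracks : Vec ℕ c

  -- Runs on a fixed input: reading a track, writing a track, moving the work head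

  module Run (w : List (Fin m)) where

    B : ℕ
    B = suc (length w)

    data _⟶_ : Conf → Conf → Set where
      step : ∀ {s i x y u ts t s′ μ i′ x′ y′ u′ t′ ts′} →
        statusOf s ≡ running →
        lookup ts (currentTrack s) ≡ t →
        transition s (tapeAt w i) (isZero x) (isZero y) (isZero u) (isZero t) ≡ (s′ , μ) →
        moveIn B (Moves.input μ) i ≡ just i′ →
        moveIn B (Moves.x μ) x ≡ just x′ →
        moveIn B (Moves.y μ) y ≡ just y′ →
        moveIn B (Moves.u μ) u ≡ just u′ →
        moveIn B (Moves.track μ) t ≡ just t′ →
        ts [ currentTrack s ]≔ t′ ≡ ts′ →
        conf s i x y u ts ⟶ conf s′ i′ x′ y′ u′ ts′

    -- Only the input head is considered: the simulation keeps all other heads on the tape.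
    Stuck : Conf → Set
    Stuck (conf s i x y u ts) = statusOf s ≡ running × ∃ λ s′ → ∃ λ μ →
      transition s (tapeAt w i) (isZero x) (isZero y) (isZero u) (isZero (lookup ts (currentTrack s)))
        ≡ (s′ , μ) × moveIn B (Moves.input μ) i ≡ nothing

    -- The number is only an upper bound on the length of the run.
    data Reach : ℕ → Conf → Conf → Set where
      done : ∀ {k a} → Reach k a a
      _∷_ : ∀ {k a b d} → a ⟶ b → Reach k b d → Reach (suc k) a d

    weaken : ∀ {k l a b} → k ≤ l → Reach k a b → Reach l a b
    weaken le done = done
    weaken (s≤s le) (s ∷ r) = s ∷ weaken le r

    infixr 5 _⊕_
    _⊕_ : ∀ {k l a b d} → Reach k a b → Reach l b d → Reach (k + l) a d
    _⊕_ {k} {l} done r = weaken (m≤n+m l k) r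
    (s ∷ r) ⊕ r′ = s ∷ (r ⊕ r′)

    once : ∀ {a b} → a ⟶ b → Reach 1 a b
    once s = s ∷ done

    -- The sum `x′` stays fixed while `y` is poured into `x`, so one bound on it covers every step.
    -- The other loops use the same form.
    drain-y : ∀ {ctl k i u ts} y {x x′} → y + x ≡ x′ → x′ ≤ B →
      Reach y (conf (draining ctl k) i x y u ts) (conf (draining ctl k) i x′ 0 u ts)
    drain-y zero refl le = done
    drain-y (suc y) {x} refl le =
      step refl refl refl refl (moveIn-right (≤-trans (s≤s (m≤n+m x y)) le)) refl refl refl
        ([]≔-lookup _ _)
      ∷ drain-y y (+-suc y x) le

    drain-u-track : ∀ {ctl bs j i x ts} u {N N′} → u + N ≡ N′ → N′ ≤ B →
      Reach u (conf (draining ctl (read bs j)) i x 0 u (ts [ j ]≔ N))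
              (conf (draining ctl (read bs j)) i x 0 0 (ts [ j ]≔ N′))
    drain-u-track zero refl le = done
    drain-u-track {j = j} {ts = ts} (suc u) {N} refl le =
      step refl (lookup∘update j ts N) refl refl refl refl refl
        (moveIn-right (≤-trans (s≤s (m≤n+m N u)) le)) ([]≔-idempotent ts j)
      ∷ drain-u-track u (+-suc u N) le

    drain-u-x : ∀ {ctl i ts} u {x x′} → u + x ≡ x′ → x′ ≤ B →
      Reach u (conf (draining ctl move) i x 0 u ts) (conf (draining ctl move) i x′ 0 0 ts)
    drain-u-x zero refl le = done
    drain-u-x (suc u) {x} refl le =
      step refl refl refl refl (moveIn-right (≤-trans (s≤s (m≤n+m x u)) le)) refl refl refl
        ([]≔-lookup _ _)
      ∷ drain-u-x u (+-suc u x) le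

    -- The hypothesis `fits` leaves room for 2 d + 1, the value of `x` after a move to the right.
    module Far (p : ℕ) (fits : 2 ^ suc p ≤ B) where

      d : ℕ
      d = mersenne p

      2d<B : suc (d + d) < B
      2d<B = subst (_≤ B) (≡-sym (suc-mersenne (suc p))) fits

      d<B : d < B
      d<B = ≤-trans (s≤s (≤-trans (m≤m+n d d) (n≤1+n _))) 2d<B

      -- While the track counts down from N, the heads x and y exchange the value d at unit speed.
      -- One exchange takes d + 1 = 2 ^ p steps, so the number of exchanges is ⌊ N / 2 ^ p ⌋; its
      -- parity tog says which of x and y is decreasing.
      clock-x clock-y : Bool → ℕ → ℕ → ℕ
      clock-x tog a e = if tog then e else a
      clock-y tog a e = if tog then a else e

      -- The current exchange has used `e` steps and `N` steps are to come, so bit `p` of `e + N` is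
      -- the parity of the exchanges still to be completed. Where `x` and `y` end is left open
      -- except for their sum.
      read-loop : ∀ {ctl bs j i ts} N tog a e {u u′ tog′} → tog′ ≡ tog xor bit p (e + N) →
        a + e ≡ d → N + u ≡ u′ → u′ ≤ B →
        ∃ λ x → ∃ λ y → x + y ≡ d ×
          Reach N (conf (reading ctl bs j tog) i (clock-x tog a e) (clock-y tog a e) u (ts [ j ]≔ N))
                  (conf (reading ctl bs j tog′) i x y u′ (ts [ j ]≔ 0))
      read-loop zero tog a e eq ae refl le
        -- No steps remain and `e` is below 2 ^ p, so its bit `p` is 0 and the toggle is final.
        with refl ← trans eq (trans (cong (tog xor_) (trans (cong (bit p) (+-identityʳ e))
               (bit-<-2^ p (subst (e <_) (suc-mersenne p) (s≤s (subst (e ≤_) ae (m≤n+m e a)))))))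
               (xor-identityʳ tog))
        = clock-x tog a e , clock-y tog a e , sum tog , done
        where
        sum : ∀ tog → clock-x tog a e + clock-y tog a e ≡ d
        sum false = ae
        sum true = trans (+-comm e a) ae
      read-loop {j = j} {ts = ts} (suc N) tog zero e {u} eq refl refl le
        -- At a turn `e` is d, so the sum is 2 ^ p + N. Dropping 2 ^ p flips bit `p`, and the
        -- flipped toggle makes up for it.
        with read-loop {ts = ts} N (not tog) d 0
          (trans eq (trans (cong (tog xor_)
            (trans (cong (bit p) (trans (+-suc d N) (cong (_+ N) (suc-mersenne p)))) (bit-+-2^ p N)))
            (trans (≡-sym (not-distribʳ-xor tog (bit p N))) (not-distribˡ-xor tog (bit p N)))))
          (+-identityʳ d) (+-suc N u) le
      ... | x , y , xy , r = x , y , xy , (turn tog ∷ r)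
        where
        u<B : u < B
        u<B = ≤-trans (s≤s (m≤n+m u N)) le
        turn : ∀ {ctl bs i} tog →
          conf (reading ctl bs j tog) i (clock-x tog 0 d) (clock-y tog 0 d) u (ts [ j ]≔ suc N) ⟶
          conf (reading ctl bs j (not tog)) i (clock-x (not tog) d 0) (clock-y (not tog) d 0) (suc u)
            (ts [ j ]≔ N)
        turn false = step refl (lookup∘update j ts _) refl refl refl refl (moveIn-right u<B) refl
          ([]≔-idempotent ts j)
        turn true = step refl (lookup∘update j ts _) refl refl refl refl (moveIn-right u<B) refl
          ([]≔-idempotent ts j)
      read-loop {j = j} {ts = ts} (suc N) tog (suc a) e {u} eq ae refl le
        with read-loop {ts = ts} N tog a (suc e)
               (trans eq (cong (λ z → tog xor bit p z) (+-suc e N))) (trans (+-suc a e) ae)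
               (+-suc N u) le
      ... | x , y , xy , r = x , y , xy , (tick tog ∷ r)
        where
        u<B : u < B
        u<B = ≤-trans (s≤s (m≤n+m u N)) le
        e<B : e < B
        e<B = ≤-<-trans (subst (e ≤_) ae (m≤n+m e (suc a))) d<B
        tick : ∀ {ctl bs i} tog →
          conf (reading ctl bs j tog) i (clock-x tog (suc a) e) (clock-y tog (suc a) e) u
            (ts [ j ]≔ suc N) ⟶
          conf (reading ctl bs j tog) i (clock-x tog a (suc e)) (clock-y tog a (suc e)) (suc u)
            (ts [ j ]≔ N)
        tick false = step refl (lookup∘update j ts _) refl refl refl (moveIn-right e<B)
          (moveIn-right u<B) refl ([]≔-idempotent ts j)
        tick true = step refl (lookup∘update j ts _) refl refl (moveIn-right e<B) refl
          (moveIn-right u<B) refl ([]≔-idempotent ts j)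

      -- N steps count down, one stores the bit, at most d return `y` to `x`, and N restore the
      -- track from `u`. The equation `restore` shows entry `j` of `ts` in the form that the loops
      -- update.
      read-track : ∀ {ctl bs i ts} j {N} → ts [ j ]≔ N ≡ ts → N ≤ B →
        Reach (N + suc (d + N))
          (conf (reading ctl bs j false) i d 0 0 ts)
          (conf (draining ctl (read (bs [ j ]≔ bit p N) j)) i d 0 0 ts)
      read-track {ctl} {bs} {i} {ts} j {N} restore le
        with read-loop {ctl} {bs} {j} {i} {ts} N false d 0 refl (+-identityʳ d) (+-identityʳ N) le
      ... | x , y , xy , r = subst
        (λ v → Reach (N + suc (d + N)) (conf (reading ctl bs j false) i d 0 0 v)
                 (conf (draining ctl (read (bs [ j ]≔ bit p N) j)) i d 0 0 v))
        restore
        (r ⊕ step refl (lookup∘update j ts 0) refl refl refl refl refl refl ([]≔-idempotent ts j)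
           ∷ (weaken (subst (y ≤_) xy (m≤n+m y x)) (drain-y y (trans (+-comm y x) xy) (<⇒≤ d<B))
             ⊕ drain-u-track N (+-identityʳ N) le))

      write-loop : ∀ {ctl dw old new j i ts N′} x {y N y′} →
        Shift (bitMove (lookup old j) (lookup new j)) (suc x) N N′ → N′ ≤ B → x + y ≡ y′ → y′ ≤ B →
        Reach (suc x) (conf (writing ctl dw old new j) i x y 0 (ts [ j ]≔ N))
                      (conf (draining ctl (write dw old new j)) i 0 y′ 0 (ts [ j ]≔ N′))
      write-loop {old = old} {new} {j} {ts = ts} zero sh le refl le′
        with shift-step (bitMove (lookup old j) (lookup new j)) 0 le sh
      ... | N₁ , e , sh′ with refl ← shift-0 (bitMove (lookup old j) (lookup new j)) sh′ =
        once (step refl (lookup∘update j ts _) refl refl refl refl refl e ([]≔-idempotent ts j))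
      write-loop {old = old} {new} {j} {ts = ts} (suc x) {y} sh le refl le′
        with shift-step (bitMove (lookup old j) (lookup new j)) (suc x) le sh
      ... | N₁ , e , sh′ =
        step refl (lookup∘update j ts _) refl refl refl
          (moveIn-right (≤-trans (s≤s (m≤n+m y x)) le′)) refl e ([]≔-idempotent ts j)
        ∷ write-loop x sh′ le (+-suc x y) le′

      write-track : ∀ {ctl dw old new i ts} j {N} → ts [ j ]≔ N ≡ ts → lookup old j ≡ bit p N →
        setBit p (lookup new j) N ≤ B →
        Reach (suc d + d)
          (conf (writing ctl dw old new j) i d 0 0 ts)
          (conf (draining ctl (write dw old new j)) i d 0 0 (ts [ j ]≔ setBit p (lookup new j) N))
      write-track {ctl} {dw} {old} {new} {i} {ts} j {N} restore eq le = subst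
        (λ v → Reach (suc d + d) (conf (writing ctl dw old new j) i d 0 0 v)
                 (conf (draining ctl (write dw old new j)) i d 0 0 (ts [ j ]≔ setBit p (lookup new j) N)))
        restore
        (write-loop d
          (subst₂ (λ b k → Shift (bitMove b (lookup new j)) k N (setBit p (lookup new j) N))
            (≡-sym eq) (≡-sym (suc-mersenne p)) (shift-setBit p (lookup new j) N))
          le (+-identityʳ d) (<⇒≤ d<B)
        ⊕ drain-y d (+-identityʳ d) (<⇒≤ d<B))

      doubling-loop : ∀ {ctl i ts} x {y u y′ u′} → x + y ≡ y′ → x + u ≡ u′ → y′ ≤ B → u′ ≤ B →
        Reach x (conf (doubling ctl) i x y u ts) (conf (doubling ctl) i 0 y′ u′ ts)
      doubling-loop zero refl refl _ _ = done
      doubling-loop (suc x) {y} {u} refl refl le le′ =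
        step refl refl refl refl refl (moveIn-right (≤-trans (s≤s (m≤n+m y x)) le))
          (moveIn-right (≤-trans (s≤s (m≤n+m u x)) le′)) refl ([]≔-lookup _ _)
        ∷ doubling-loop x (+-suc x y) (+-suc x u) le le′

      move-right : ∀ {ctl i ts} → Reach (3 * d + 2) (conf (doubling ctl) i d 0 0 ts)
                                                    (conf (far ctl) i (mersenne (suc p)) 0 0 ts)
      move-right = weaken (≤-reflexive (count d))
        (doubling-loop d (+-identityʳ d) (+-identityʳ d) (<⇒≤ d<B) (<⇒≤ d<B)
        ⊕ step refl refl refl refl refl refl refl refl ([]≔-lookup _ _)
        ∷ (drain-y d (+-comm d 1) d<B
        ⊕ drain-u-x d (+-suc d d) (<⇒≤ 2d<B)
        ⊕ once (step refl refl refl refl refl refl refl refl ([]≔-lookup _ _))))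
        where
        count : ∀ d → d + suc (d + (d + 1)) ≡ 3 * d + 2
        count = solve-∀

    halving-loop : ∀ {ctl i ts} e {u u′} → e + u ≡ u′ → u′ ≤ B →
      Reach (e + e) (conf (halvingEven ctl) i (e + e) 0 u ts) (conf (halvingEven ctl) i 0 0 u′ ts)
    halving-loop zero refl _ = done
    halving-loop (suc e) {u} refl le rewrite +-suc e e =
      step refl refl refl refl refl refl (moveIn-right (≤-trans (s≤s (m≤n+m u e)) le)) refl ([]≔-lookup _ _)
      ∷ step refl refl refl refl refl refl refl refl ([]≔-lookup _ _)
      ∷ halving-loop e (+-suc e u) le

    -- The first step removes the odd unit of 2 e + 1; then `u` counts the e pairs and is poured
    -- into the emptied `x`.
    move-left : ∀ {ctl i ts} p → mersenne p ≤ B →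
      Reach (3 * mersenne (suc p) + 2) (conf (halvingOdd ctl) i (mersenne (suc p)) 0 0 ts)
                                       (conf (far ctl) i (mersenne p) 0 0 ts)
    move-left p le = weaken count
      (step refl refl refl refl refl refl refl refl ([]≔-lookup _ _)
      ∷ (halving-loop e (+-identityʳ e) le
      ⊕ step refl refl refl refl refl refl refl refl ([]≔-lookup _ _)
      ∷ (drain-u-x e (+-identityʳ e) le
      ⊕ once (step refl refl refl refl refl refl refl refl ([]≔-lookup _ _)))))
      where
      e : ℕ
      e = mersenne p
      -- The bound is generous here: it has the same form 3 d + 2 as for `move-right`, so that both
      -- directions share it.
      slack : ∀ e → suc (e + e + suc (e + 1)) + (3 * e + 2) ≡ 3 * suc (e + e) + 2
      slack = solve-∀
      count : suc (e + e + suc (e + 1)) ≤ 3 * mersenne (suc p) + 2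
      count = subst (suc (e + e + suc (e + 1)) ≤_) (slack e) (m≤m+n _ (3 * e + 2))

-- Simulation of one Turing machine step

module Simulation {c′ m g : ℕ} (M : TM m g) (g≤2^c : g ≤ 2 ^ suc c′) (w : List (Fin m)) where

  open TM M
  open SymbolCode {c = suc c′} g≤2^c blank
  open Machine {c′} M g≤2^c
  open Run w

  -- `S` counts the work cells stored on the tracks and `E` bounds the track positions. `T` is twice
  -- the time allowed per step, which clears the fraction 3/2.
  n L S E T : ℕ
  n = length w
  L = ⌊log₂ (n + 2) ⌋
  S = L ∸ 2
  E = 2 ^ S
  T = (4 * c + 3) * n + 4 * c + 4

  -- One pass from the last track to the first, used for the bits read and for the track positions
  -- written. Invariant: entries above the current index agree with `tgt`, the others still with
  -- `src`. Each track is charged `K` steps and one for the change to the next.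
  sweep : ∀ {A : Set} {K} (src tgt : Vec A c) (f h : Vec A c → Fin c → Conf) →
    (∀ cur j → lookup cur j ≡ lookup src j → Reach K (f cur j) (h (cur [ j ]≔ lookup tgt j) j)) →
    (∀ cur j → h cur (suc j) ⟶ f cur (inject₁ j)) →
    Reach (c * suc K) (f src (fromℕ c′)) (h tgt zero)
  sweep {A} {K} src tgt f h body next-track =
    subst (λ k → Reach (suc k * suc K) (f src (fromℕ c′)) (h tgt zero)) (toℕ-fromℕ c′)
      (<-weakInduction P base ind (fromℕ c′) src
        (λ j lt → ⊥-elim (<⇒≱ lt (subst (toℕ j ≤_) (≡-sym (toℕ-fromℕ c′)) (toℕ≤pred[n] j))))
        (λ _ _ → refl))
    where
    P : Fin c → Set
    P i = ∀ cur → (∀ j → toℕ i < toℕ j → lookup cur j ≡ lookup tgt j) →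
      (∀ j → toℕ j ≤ toℕ i → lookup cur j ≡ lookup src j) →
      Reach (suc (toℕ i) * suc K) (f cur i) (h tgt zero)

    updated : ∀ (cur : Vec A c) i → (∀ j → toℕ i < toℕ j → lookup cur j ≡ lookup tgt j) →
      ∀ j → toℕ i ≤ toℕ j → lookup (cur [ i ]≔ lookup tgt i) j ≡ lookup tgt j
    updated cur i above j i≤j with j Fin.≟ i
    ... | yes refl = lookup∘update i cur _
    ... | no j≢i = trans (lookup∘update′ j≢i cur _)
      (above j (≤∧≢⇒< i≤j (λ e → j≢i (≡-sym (toℕ-injective e)))))

    base : P zero
    base cur above below = weaken (≤-trans (n≤1+n K) (m≤m+n (suc K) 0))
      (subst (λ v → Reach K (f cur zero) (h v zero)) (lookup-ext (λ j → updated cur zero above j z≤n))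
        (body cur zero (below zero z≤n)))

    ind : ∀ i → P (inject₁ i) → P (suc i)
    ind i ih cur above below =
      weaken (≤-reflexive (+-suc K (suc (toℕ i) * suc K)))
        (body cur (suc i) (below (suc i) ≤-refl)
        ⊕ next-track _ i
        ∷ subst (λ k → Reach (suc k * suc K) (f (cur [ suc i ]≔ lookup tgt (suc i)) (inject₁ i)) (h tgt zero))
            (toℕ-inject₁ i)
            (ih (cur [ suc i ]≔ lookup tgt (suc i))
              (λ j lt → updated cur (suc i) above j (subst (λ k → suc k ≤ toℕ j) (toℕ-inject₁ i) lt))
              (λ j le → let le′ = subst (toℕ j ≤_) (toℕ-inject₁ i) le in
                trans (lookup∘update′ (λ { refl → <-irrefl refl le′ }) cur _)
                  (below j (m≤n⇒m≤1+n le′)))))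

  -- Stated for every `j`: by the second condition all bits from `S` on are 0, so the cells from
  -- `2 + S` on are blank.
  TracksHold : (ℕ → Fin g) → Vec ℕ c → Set
  TracksHold f ts = (∀ j → f (2 + j) ≡ decode (map (bit j) ts)) × (∀ k → lookup ts k < E)

  data Represents : TMConfig M → Conf → Set where
    near₀ : ∀ {q i f ts} → TracksHold f ts →
      Represents (tmcfg q i 0 f) (conf (near (q , f 0 , f 1) false) i 0 0 0 ts)
    near₁ : ∀ {q i f ts} → TracksHold f ts →
      Represents (tmcfg q i 1 f) (conf (near (q , f 0 , f 1) true) i 0 0 0 ts)
    far : ∀ {q i f ts} p → TracksHold f ts →
      Represents (tmcfg q i (2 + p) f) (conf (far (q , f 0 , f 1)) i (mersenne p) 0 0 ts)

  -- The last two cases are the two ways the Turing machine can break down: the work head leaves its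
  -- tape, or the input head does. In `sticks` the failing step itself is charged as well.
  data Simulated (r : Maybe (TMConfig M)) (a : Conf) : Set where
    continues : ∀ {K b C} → 2 * K ≤ T → Reach K a b → Represents C b → r ≡ just C → Simulated r a
    rejects : ∀ {K b} → 2 * K ≤ T → Reach K a b → statusOf (Conf.state b) ≡ rejecting →
      r ≡ nothing → Simulated r a
    sticks : ∀ {K b} → 2 * suc K ≤ T → Reach K a b → Stuck b → r ≡ nothing → Simulated r a

  tracksHold-init : TracksHold (λ _ → blank) (replicate c 0)
  tracksHold-init =
    (λ j → ≡-sym (trans (cong decode (trans (map-replicate (bit j) 0 c)
      (cong (replicate c) (bit-0 j)))) decode-replicate-false)) ,
    (λ k → subst (_< E) (≡-sym (lookup-replicate k 0)) (m^n>0 2 S))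

  -- Setting bit `p` of every track changes only the code of cell `2 + p`, and `p < S` keeps the
  -- positions below 2 ^ S.
  tracksHold-write : ∀ {p f ts} s → p < S → TracksHold f ts →
    TracksHold (writeTape M (2 + p) s f) (zipWith (setBit p) (encode s) ts)
  tracksHold-write {p} {f} {ts} s p<S (cells , small) = cells′ , small′
    where
    ts′ : Vec ℕ c
    ts′ = zipWith (setBit p) (encode s) ts

    lookup-ts′ : ∀ k → lookup ts′ k ≡ setBit p (lookup (encode s) k) (lookup ts k)
    lookup-ts′ k = lookup-zipWith (setBit p) k (encode s) ts

    small′ : ∀ k → lookup ts′ k < E
    small′ k = subst (_< E) (≡-sym (lookup-ts′ k)) (setBit-< (lookup (encode s) k) p<S (small k))

    lookup-bits : ∀ j k → lookup (map (bit j) ts′) k ≡ bit j (setBit p (lookup (encode s) k) (lookup ts k))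
    lookup-bits j k = trans (lookup-map k (bit j) ts′) (cong (bit j) (lookup-ts′ k))

    cells′ : ∀ j → writeTape M (2 + p) s f (2 + j) ≡ decode (map (bit j) ts′)
    cells′ j with j ≟ p
    ... | yes refl = trans (writeTape-≡ M j s (λ k → f (2 + k)))
      (≡-sym (trans (cong decode (lookup-ext {ys = encode s} λ k → trans (lookup-bits j k)
        (bit-setBit j (lookup (encode s) k) (lookup ts k)))) (decode-encode s)))
    ... | no j≢p = trans (writeTape-≢ M p s (λ k → f (2 + k)) j≢p)
      (trans (cells j) (cong decode (lookup-ext λ k → trans (lookup-map k (bit j) ts)
        (≡-sym (trans (lookup-bits j k) (bit-setBit-≢ p (lookup (encode s) k) (lookup ts k) j≢p))))))

  module FarStep (p : ℕ) (p<S : p < S) (E≤B : E ≤ B) where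

    fits : 2 ^ suc p ≤ B
    fits = ≤-trans (^-monoʳ-≤ 2 p<S) E≤B

    open Far p fits

    read-all : ∀ {ctl i ts} → status (proj₁ ctl) ≡ running → (∀ k → lookup ts k < E) →
      Reach (suc (c * suc (E + E + d))) (conf (far ctl) i d 0 0 ts)
        (conf (draining ctl (read (map (bit p) ts) zero)) i d 0 0 ts)
    read-all {ctl} {i} {ts} run small =
      step run refl refl refl refl refl refl refl ([]≔-lookup _ _)
      ∷ sweep (replicate c false) (map (bit p) ts)
          (λ bs j → conf (reading ctl bs j false) i d 0 0 ts)
          (λ bs j → conf (draining ctl (read bs j)) i d 0 0 ts)
          (λ bs j _ → weaken (cost j)
            (subst (λ b → Reach (lookup ts j + suc (d + lookup ts j)) (conf (reading ctl bs j false) i d 0 0 ts)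
                            (conf (draining ctl (read (bs [ j ]≔ b) j)) i d 0 0 ts))
              (≡-sym (lookup-map j (bit p) ts))
              (read-track j ([]≔-lookup ts j) (≤-trans (<⇒≤ (small j)) E≤B))))
          (λ bs j → step refl refl refl refl refl refl refl refl ([]≔-lookup _ _))
      where
      cost : ∀ j → lookup ts j + suc (d + lookup ts j) ≤ E + E + d
      cost j = begin
        lookup ts j + suc (d + lookup ts j) ≡⟨ rearrange (lookup ts j) d ⟩
        -- The strict inequality between the track position and `E` pays for the step that stores
        -- the bit.
        suc (lookup ts j) + lookup ts j + d ≤⟨ +-monoˡ-≤ d (+-mono-≤ (small j) (<⇒≤ (small j))) ⟩
        E + E + d ∎
        where
        open ≤-Reasoning
        rearrange : ∀ N d → N + suc (d + N) ≡ suc N + N + d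
        rearrange = solve-∀

    write-all : ∀ {ctl dw i ts} new → (∀ k → lookup ts k < E) →
      Reach (c * suc (suc d + d)) (conf (writing ctl dw (map (bit p) ts) new (fromℕ c′)) i d 0 0 ts)
        (conf (draining ctl (write dw (map (bit p) ts) new zero)) i d 0 0 (zipWith (setBit p) new ts))
    write-all {ctl} {dw} {i} {ts} new small =
      sweep ts (zipWith (setBit p) new ts)
        (λ cur j → conf (writing ctl dw (map (bit p) ts) new j) i d 0 0 cur)
        (λ cur j → conf (draining ctl (write dw (map (bit p) ts) new j)) i d 0 0 cur)
        (λ cur j e →
          subst (λ N → Reach (suc d + d) (conf (writing ctl dw (map (bit p) ts) new j) i d 0 0 cur)
                         (conf (draining ctl (write dw (map (bit p) ts) new j)) i d 0 0 (cur [ j ]≔ N)))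
            (≡-sym (lookup-zipWith (setBit p) j new ts))
            (write-track j (trans (cong (cur [ j ]≔_) (≡-sym e)) ([]≔-lookup cur j))
              (lookup-map j (bit p) ts)
              (≤-trans (<⇒≤ (setBit-< (lookup new j) p<S (small j))) E≤B)))
        (λ cur j → step refl refl refl refl refl refl refl refl ([]≔-lookup _ _))

    finish : ∀ dw {q i f ts old new} → TracksHold f ts →
      ∃ λ p′ → ∃ λ b → moveWork dw (2 + p) ≡ just p′ ×
        Reach (suc (3 * d + 2)) (conf (draining (q , f 0 , f 1) (write dw old new zero)) i d 0 0 ts) b ×
        Represents (tmcfg q i p′ f) b
    finish stay hold = _ , _ , refl ,
      step refl refl refl refl refl refl refl refl ([]≔-lookup _ _) ∷ done , far p hold
    finish right hold = _ , _ , refl ,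
      step refl refl refl refl refl refl refl refl ([]≔-lookup _ _) ∷ move-right , far (suc p) hold
    -- `go` takes the index as a variable for a case split: from index 0 the head enters cell 1,
    -- held in the control.
    finish left hold = go p (<⇒≤ d<B) hold
      where
      go : ∀ p {q i f ts old new} → mersenne p ≤ B → TracksHold f ts →
        ∃ λ p′ → ∃ λ b → just (suc p) ≡ just p′ ×
          Reach (suc (3 * mersenne p + 2))
            (conf (draining (q , f 0 , f 1) (write left old new zero)) i (mersenne p) 0 0 ts) b ×
          Represents (tmcfg q i p′ f) b
      go zero _ hold = _ , _ , refl ,
        step refl refl refl refl refl refl refl refl ([]≔-lookup _ _)
        ∷ step refl refl refl refl refl refl refl refl ([]≔-lookup _ _) ∷ done , near₁ hold
      go (suc p) le hold = _ , _ , refl ,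
        step refl refl refl refl refl refl refl refl ([]≔-lookup _ _)
        ∷ move-left p (≤-trans (≤-trans (m≤m+n _ _) (n≤1+n _)) le) , far p hold

    total : ℕ
    total = suc (c * suc (E + E + d)) + suc (c * suc (suc d + d) + suc (3 * d + 2))

    total-bound : 4 * E ≤ n + 2 → 2 * total ≤ T
    -- Adding 4 c + 2 turns `T` into (4 c + 3) (n + 2), to which 4 E ≤ n + 2 applies. On the left, 2
    -- (d + 1) ≤ E and 1 ≤ E give (11 c + 9) E, and a slack of (5 c + 3) E fills this up to (4 c +
    -- 3) 4 E.
    total-bound 4E≤n+2 = +-cancelʳ-≤ (4 * c + 2) (2 * total) T (begin
      2 * total + (4 * c + 2) ≡⟨ expand c E d ⟩
      4 * (c * E) + (3 * c + 3) * (2 * suc d) + (4 * c + 6) * 1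
        ≤⟨ +-mono-≤ (+-monoʳ-≤ (4 * (c * E)) (*-monoʳ-≤ (3 * c + 3) 2D≤E))
             (*-monoʳ-≤ (4 * c + 6) (m^n>0 2 S)) ⟩
      4 * (c * E) + (3 * c + 3) * E + (4 * c + 6) * E ≤⟨ m≤m+n _ ((5 * c + 3) * E) ⟩
      4 * (c * E) + (3 * c + 3) * E + (4 * c + 6) * E + (5 * c + 3) * E ≡⟨ collect c E ⟩
      (4 * c + 3) * (4 * E) ≤⟨ *-monoʳ-≤ (4 * c + 3) 4E≤n+2 ⟩
      (4 * c + 3) * (n + 2) ≡⟨ split c n ⟩
      T + (4 * c + 2) ∎)
      where
      open ≤-Reasoning
      2D≤E : 2 * suc d ≤ E
      2D≤E = subst (λ k → 2 * k ≤ E) (≡-sym (suc-mersenne p)) (^-monoʳ-≤ 2 p<S)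
      expand : ∀ c E d →
        2 * (suc (c * suc (E + E + d)) + suc (c * suc (suc d + d) + suc (3 * d + 2))) + (4 * c + 2) ≡
        4 * (c * E) + (3 * c + 3) * (2 * suc d) + (4 * c + 6) * 1
      expand = solve-∀
      collect : ∀ c E →
        4 * (c * E) + (3 * c + 3) * E + (4 * c + 6) * E + (5 * c + 3) * E ≡ (4 * c + 3) * (4 * E)
      collect = solve-∀
      split : ∀ c n → (4 * c + 3) * (n + 2) ≡ (4 * c + 3) * n + 4 * c + 4 + (4 * c + 2)
      split = solve-∀

  private
    near-cost : 2 ≤ T
    near-cost = ≤-trans (s≤s (s≤s z≤n)) (m≤n+m 4 ((4 * c + 3) * n + 4 * c))

    bind-nothing : ∀ {A C : Set} (r : Maybe A) → (r >>= λ _ → nothing {A = C}) ≡ nothing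
    bind-nothing nothing = refl
    bind-nothing (just _) = refl

    -- A work head on cell `2 + p` forces L > 2, so the subtraction in `S` is exact and 4 E = 2 ^ L
    -- ≤ n + 2.
    far-fits : ∀ {p} → 2 + p < L → p < S × 4 * E ≤ n + 2
    far-fits {p} lt = ∸-monoˡ-≤ 2 lt ,
      (begin
        4 * 2 ^ S ≡⟨ *-assoc 2 2 (2 ^ S) ⟩
        2 ^ (2 + S) ≡⟨ cong (2 ^_) (m+[n∸m]≡n (≤-trans (s≤s (s≤s z≤n)) lt)) ⟩
        2 ^ L ≡⟨ cong (λ k → 2 ^ ⌊log₂ k ⌋) (+-comm n 2) ⟩
        2 ^ ⌊log₂ 2 + n ⌋ ≤⟨ 2^⌊log₂⌋≤ (suc n) ⟩
        2 + n ≡⟨ +-comm 2 n ⟩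
        n + 2 ∎)
      where open ≤-Reasoning

    near-step : ∀ {C s i ts s′ di q p f} → statusOf s ≡ running →
      transition s (tapeAt w i) true true true (isZero (lookup ts (currentTrack s)))
        ≡ (s′ , moves di stay stay stay stay) →
      stepTM M w C ≡ (moveIn B di i >>= λ i′ → just (tmcfg q i′ p f)) →
      (∀ i′ → Represents (tmcfg q i′ p f) (conf s′ i′ 0 0 0 ts)) →
      Simulated (stepTM M w C) (conf s i 0 0 0 ts)
    near-step {i = i} {di = di} run eq stepEq rep with moveIn B di i in mv
    ... | nothing = sticks near-cost (done {0}) (run , _ , _ , eq , mv) stepEq
    ... | just i′ = continues near-cost
      (once (step run refl eq mv refl refl refl refl ([]≔-lookup _ _))) (rep i′) stepEq

    -- The input head moves between reading and writing, in the step that applies `δ`. If it leaves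
    -- the tape, the run breaks off there.
    far-step : ∀ {q i f ts} p → TracksHold f ts → 2 + p < L → status q ≡ running →
      Simulated (stepTM M w (tmcfg q i (2 + p) f)) (conf (far (q , f 0 , f 1)) i (mersenne p) 0 0 ts)
    far-step {q} {i} {f} {ts} p hold@(cells , small) lt run
      with δ q (tapeAt w i) (f (2 + p)) in eq
    ... | q′ , di , s , dw = go (moveIn B di i) refl
      where
      p<S : p < S
      p<S = proj₁ (far-fits lt)

      4E≤n+2 : 4 * E ≤ n + 2
      4E≤n+2 = proj₂ (far-fits lt)

      E≤B : E ≤ B
      E≤B = *-cancelˡ-≤ 2 (begin
        2 * E ≤⟨ m≤m+n (2 * E) (2 * E) ⟩
        2 * E + 2 * E ≡⟨ ≡-sym (*-distribʳ-+ E 2 2) ⟩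
        4 * E ≤⟨ 4E≤n+2 ⟩
        n + 2 ≤⟨ +-monoˡ-≤ 2 (m≤m+n n (n + 0)) ⟩
        2 * n + 2 ≡⟨ trans (+-comm (2 * n) 2) (≡-sym (*-suc 2 n)) ⟩
        2 * B ∎)
        where open ≤-Reasoning

      open FarStep p p<S E≤B

      bits : Vec Bool c
      bits = map (bit p) ts

      writes : next (q , f 0 , f 1) (read bits zero) (tapeAt w i) ≡
        startWriting (f 0) (f 1) bits (q′ , di , s , dw)
      writes = cong (startWriting (f 0) (f 1) bits)
        (trans (cong (δ q (tapeAt w i)) (≡-sym (cells p))) eq)

      go : ∀ r → moveIn B di i ≡ r →
        Simulated (stepTM M w (tmcfg q i (2 + p) f)) (conf (far (q , f 0 , f 1)) i (mersenne p) 0 0 ts)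
      go nothing mv = sticks
        (≤-trans (*-monoʳ-≤ 2 early) (total-bound 4E≤n+2))
        (read-all run small) (refl , _ , _ , writes , mv)
        (trans (stepTM-running M w q i (2 + p) f run eq) (cong (_>>= _) mv))
        where
        early : suc (suc (c * suc (E + E + mersenne p))) ≤ total
        early = subst (suc (suc (c * suc (E + E + mersenne p))) ≤_)
          (≡-sym (+-suc (suc (c * suc (E + E + mersenne p))) _)) (s≤s (m≤m+n _ _))
      go (just i′) mv
        with finish dw {q′} {i′} {writeTape M (2 + p) s f} {old = bits} {new = encode s}
               (tracksHold-write {f = f} s p<S hold)
      ... | p′ , b , moved , r , rep = continues (total-bound 4E≤n+2)
        (read-all run small
        ⊕ step refl refl writes mv refl refl refl refl ([]≔-lookup _ _)
        ∷ (write-all (encode s) small ⊕ r))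
        rep
        (trans (stepTM-running M w q i (2 + p) f run eq)
          (trans (cong (_>>= _) mv) (cong (_>>= _) moved)))

  simulate : ∀ {C a} → Represents C a → TMConfig.workPos C < L → status (TMConfig.state C) ≡ running →
    Simulated (stepTM M w C) a
  simulate (near₀ {q} {i} {f} hold) _ run
    with δ q (tapeAt w i) (f 0) in eq | stepTM-running M w q i 0 f run refl
  ... | q′ , di , s , left | e = rejects near-cost
    (once (step run refl (cong (nearFirst (f 1)) eq) refl refl refl refl refl ([]≔-lookup _ _))) refl
    (trans e (bind-nothing (moveIn B di i)))
  -- A write to cell 0 or 1 leaves the later cells the same by computation, so `hold` serves for the
  -- new tape.
  ... | q′ , di , s , stay | e =
    near-step run (cong (nearFirst (f 1)) eq) e λ _ → near₀ {f = writeTape M 0 s f} hold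
  ... | q′ , di , s , right | e =
    near-step run (cong (nearFirst (f 1)) eq) e λ _ → near₁ {f = writeTape M 0 s f} hold
  simulate (near₁ {q} {i} {f} hold) _ run
    with δ q (tapeAt w i) (f 1) in eq | stepTM-running M w q i 1 f run refl
  ... | q′ , di , s , left | e =
    near-step run (cong (nearSecond (f 0)) eq) e λ _ → near₀ {f = writeTape M 1 s f} hold
  ... | q′ , di , s , stay | e =
    near-step run (cong (nearSecond (f 0)) eq) e λ _ → near₁ {f = writeTape M 1 s f} hold
  ... | q′ , di , s , right | e =
    near-step run (cong (nearSecond (f 0)) eq) e λ _ → far {f = writeTape M 1 s f} 0 hold
  simulate (far p hold) lt run = far-step p hold lt run

-- The automaton: numbering of its states and heads

accepting≢running : accepting ≢ running
accepting≢running ()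

rejecting≢running : rejecting ≢ running
rejecting≢running ()

module Automaton {c′ m g : ℕ} (M : TM m g) (g≤2^c : g ≤ 2 ^ suc c′) where

  open Machine {c′} M g≤2^c

  phaseFinite : Finite Phase
  phaseFinite = retract
    (λ { (read bs j) → inj₁ (bs , j)
       ; (write dw old new j) → inj₂ (inj₁ (dw , old , new , j))
       ; move → inj₂ (inj₂ tt) })
    (λ { (inj₁ (bs , j)) → read bs j
       ; (inj₂ (inj₁ (dw , old , new , j))) → write dw old new j
       ; (inj₂ (inj₂ _)) → move })
    (λ { (read _ _) → refl ; (write _ _ _ _) → refl ; move → refl })
    (bitsᶠ ×ᶠ finFinite c ⊎ᶠ moveFinite ×ᶠ bitsᶠ ×ᶠ bitsᶠ ×ᶠ finFinite c ⊎ᶠ ⊤ᶠ)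
    where
    bitsᶠ : Finite (Vec Bool c)
    bitsᶠ = vecFinite boolFinite c

  abstract
    stateFinite : Finite State
    stateFinite = retract
      (λ { (near ctl b) → inj₁ (ctl , b)
         ; (far ctl) → inj₂ (inj₁ ctl)
         ; dead → inj₂ (inj₂ (inj₁ tt))
         ; (reading ctl bs j tog) → inj₂ (inj₂ (inj₂ (inj₁ (ctl , bs , j , tog))))
         ; (writing ctl dw old new j) → inj₂ (inj₂ (inj₂ (inj₂ (inj₁ (ctl , dw , old , new , j)))))
         ; (doubling ctl) → inj₂ (inj₂ (inj₂ (inj₂ (inj₂ (inj₁ ctl)))))
         ; (halvingOdd ctl) → inj₂ (inj₂ (inj₂ (inj₂ (inj₂ (inj₂ (inj₁ ctl))))))
         ; (halvingEven ctl) → inj₂ (inj₂ (inj₂ (inj₂ (inj₂ (inj₂ (inj₂ (inj₁ ctl)))))))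
         ; (draining ctl k) → inj₂ (inj₂ (inj₂ (inj₂ (inj₂ (inj₂ (inj₂ (inj₂ (ctl , k)))))))) })
      (λ { (inj₁ (ctl , b)) → near ctl b
         ; (inj₂ (inj₁ ctl)) → far ctl
         ; (inj₂ (inj₂ (inj₁ _))) → dead
         ; (inj₂ (inj₂ (inj₂ (inj₁ (ctl , bs , j , tog))))) → reading ctl bs j tog
         ; (inj₂ (inj₂ (inj₂ (inj₂ (inj₁ (ctl , dw , old , new , j)))))) → writing ctl dw old new j
         ; (inj₂ (inj₂ (inj₂ (inj₂ (inj₂ (inj₁ ctl)))))) → doubling ctl
         ; (inj₂ (inj₂ (inj₂ (inj₂ (inj₂ (inj₂ (inj₁ ctl))))))) → halvingOdd ctl
         ; (inj₂ (inj₂ (inj₂ (inj₂ (inj₂ (inj₂ (inj₂ (inj₁ ctl)))))))) → halvingEven ctl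
         ; (inj₂ (inj₂ (inj₂ (inj₂ (inj₂ (inj₂ (inj₂ (inj₂ (ctl , k))))))))) → draining ctl k })
      (λ { (near _ _) → refl ; (far _) → refl ; dead → refl ; (reading _ _ _ _) → refl
         ; (writing _ _ _ _ _) → refl ; (doubling _) → refl ; (halvingOdd _) → refl
         ; (halvingEven _) → refl ; (draining _ _) → refl })
      (ctlᶠ ×ᶠ boolFinite ⊎ᶠ ctlᶠ ⊎ᶠ ⊤ᶠ ⊎ᶠ ctlᶠ ×ᶠ bitsᶠ ×ᶠ finFinite c ×ᶠ boolFinite
        ⊎ᶠ ctlᶠ ×ᶠ moveFinite ×ᶠ bitsᶠ ×ᶠ bitsᶠ ×ᶠ finFinite c ⊎ᶠ ctlᶠ ⊎ᶠ ctlᶠ ⊎ᶠ ctlᶠ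
        ⊎ᶠ ctlᶠ ×ᶠ phaseFinite)
      where
      ctlᶠ : Finite Control
      ctlᶠ = finFinite (TM.nstates M) ×ᶠ finFinite g ×ᶠ finFinite g
      bitsᶠ : Finite (Vec Bool c)
      bitsᶠ = vecFinite boolFinite c

  -- Besides the `c` tracks there are the input head, `x`, `y`, `u`, and a head resting on ⊳ that
  -- completes the number c + 5.
  Head : Set
  Head = Fin c ⊎ Fin 5

  pattern inputHead = inj₂ zero
  pattern xHead = inj₂ (suc zero)
  pattern yHead = inj₂ (suc (suc zero))
  pattern uHead = inj₂ (suc (suc (suc zero)))
  pattern idleHead = inj₂ (suc (suc (suc (suc zero))))

  headMove : Fin c → Moves → Head → Move
  headMove j μ (inj₁ k) = if does (k Fin.≟ j) then Moves.track μ else stay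
  headMove j μ inputHead = Moves.input μ
  headMove j μ xHead = Moves.x μ
  headMove j μ yHead = Moves.y μ
  headMove j μ uHead = Moves.u μ
  headMove j μ idleHead = stay

  position : Conf → Head → ℕ
  position a (inj₁ k) = lookup (Conf.tracks a) k
  position a inputHead = Conf.inp a
  position a xHead = Conf.x a
  position a yHead = Conf.y a
  position a uHead = Conf.u a
  position a idleHead = 0

  respond : State → (Fin (c + 5) → Sym m) → Fin (size stateFinite) × (Fin (c + 5) → Move)
  respond s scanned = output (transition s (scanned (join c 5 inputHead)) (atLeftEnd xHead)
                               (atLeftEnd yHead) (atLeftEnd uHead) (atLeftEnd (inj₁ (currentTrack s))))
    where
    atLeftEnd : Head → Bool
    atLeftEnd h = isLeftEnd (scanned (join c 5 h))
    output : State × Moves → Fin (size stateFinite) × (Fin (c + 5) → Move)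
    output (s′ , μ) = index stateFinite s′ , λ h → headMove (currentTrack s) μ (splitAt c h)

  respond-≡ : ∀ s {scanned σ bx by bu bt s′ μ} → scanned (join c 5 inputHead) ≡ σ →
    isLeftEnd (scanned (join c 5 xHead)) ≡ bx → isLeftEnd (scanned (join c 5 yHead)) ≡ by →
    isLeftEnd (scanned (join c 5 uHead)) ≡ bu →
    isLeftEnd (scanned (join c 5 (inj₁ (currentTrack s)))) ≡ bt →
    transition s σ bx by bu bt ≡ (s′ , μ) →
    respond s scanned ≡ (index stateFinite s′ , λ h → headMove (currentTrack s) μ (splitAt c h))
  respond-≡ s refl refl refl refl refl eq rewrite eq = refl

  automaton : FA (c + 5) m
  automaton = record
    { nstates = size stateFinite
    ; start = index stateFinite (near (TM.start M , TM.blank M , TM.blank M) false)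
    ; status = λ q → statusOf (element stateFinite q)
    ; δ = λ q scanned → respond (element stateFinite q) scanned
    }

  -- Automaton runs follow Turing machine runs

  module Correctness (w : List (Fin m)) where

    open Run w
    open Simulation {c′} M g≤2^c w hiding (near₀; near₁; far)

    -- Positions are compared pointwise, since `allJust` yields a function whose values alone are
    -- known.
    Implements : FAConfig automaton → Conf → Set
    Implements D a = FAConfig.state D ≡ index stateFinite (Conf.state a) ×
      (∀ h → FAConfig.pos D h ≡ position a (splitAt c h))

    status-implements : ∀ {D a} → Implements D a →
      FA.status automaton (FAConfig.state D) ≡ statusOf (Conf.state a)
    status-implements {a = a} (refl , _) = cong statusOf (element-index stateFinite (Conf.state a))

    δ-implements : ∀ {D s i x y u ts s′ μ} → Implements D (conf s i x y u ts) →
      transition s (tapeAt w i) (isZero x) (isZero y) (isZero u) (isZero (lookup ts (currentTrack s)))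
        ≡ (s′ , μ) →
      FA.δ automaton (FAConfig.state D) (λ h → tapeAt w (FAConfig.pos D h)) ≡
        (index stateFinite s′ , λ h → headMove (currentTrack s) μ (splitAt c h))
    δ-implements {D} {s} {i} {x} {y} {u} {ts} (refl , pos≡) eq =
      trans (cong (λ s → respond s (λ h → tapeAt w (FAConfig.pos D h))) (element-index stateFinite s))
        (respond-≡ s {λ h → tapeAt w (FAConfig.pos D h)} (cong (tapeAt w) (at inputHead))
          (leftEnd xHead) (leftEnd yHead) (leftEnd uHead)
          (leftEnd (inj₁ (currentTrack s))) eq)
      where
      at : ∀ h → FAConfig.pos D (join c 5 h) ≡ position (conf s i x y u ts) h
      at h = trans (pos≡ (join c 5 h)) (cong (position (conf s i x y u ts)) (splitAt-join c 5 h))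
      leftEnd : ∀ h → isLeftEnd (tapeAt w (FAConfig.pos D (join c 5 h))) ≡
        isZero (position (conf s i x y u ts) h)
      leftEnd h = trans (isLeftEnd-tapeAt w _) (cong isZero (at h))

    step-implements : ∀ {D a b} → Implements D a → a ⟶ b →
      ∃ λ D′ → stepFA automaton w D ≡ just D′ × Implements D′ b
    step-implements {D} {a} {b} imp@(_ , pos≡) (step {s = s} {μ = μ} run refl eq mi mx my mu mt refl)
      with stepFA-just automaton w (λ h → position b (splitAt c h))
             (trans (status-implements {D} imp) run) (δ-implements {D} imp eq)
             (λ h → trans (cong (moveIn B (headMove (currentTrack s) μ (splitAt c h))) (pos≡ h))
                      (moved (splitAt c h)))
      where
      moved : ∀ h → moveIn B (headMove (currentTrack s) μ h) (position a h) ≡ just (position b h)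
      moved (inj₁ k) with k Fin.≟ currentTrack s
      ... | yes refl = trans mt (cong just (≡-sym (lookup∘update k (Conf.tracks a) _)))
      ... | no k≢j = cong just (≡-sym (lookup∘update′ k≢j (Conf.tracks a) _))
      moved inputHead = mi
      moved xHead = mx
      moved yHead = my
      moved uHead = mu
      moved idleHead = refl
    ... | ps , e , ps≡ = _ , e , refl , ps≡

    stuck-implements : ∀ {D a} → Implements D a → Stuck a → stepFA automaton w D ≡ nothing
    stuck-implements {D} {a} imp@(_ , pos≡) (run , s′ , μ , eq , fails) =
      stepFA-nothing automaton w (join c 5 inputHead) (trans (status-implements {D} imp) run)
        (δ-implements {D} imp eq)
        (trans (cong₂ (λ h p → moveIn B (headMove (currentTrack (Conf.state a)) μ h) p)
                 (splitAt-join c 5 inputHead)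
                 (trans (pos≡ (join c 5 inputHead)) (cong (position a) (splitAt-join c 5 inputHead))))
          fails)

    reach-implements : ∀ {K a b} i {D} → Reach K a b → runFA automaton w i ≡ just D → Implements D a →
      ∃ λ k → k ≤ K × ∃ λ D′ → runFA automaton w (k + i) ≡ just D′ × Implements D′ b
    reach-implements i done e imp = 0 , z≤n , _ , e , imp
    reach-implements i (s ∷ r) e imp with step-implements imp s
    ... | D₁ , e₁ , imp₁ with reach-implements (suc i) r (trans (cong (_>>= _) e) e₁) imp₁
    ... | k , k≤K , D′ , e′ , imp′ =
      suc k , s≤s k≤K , D′ , trans (cong (runFA automaton w) (≡-sym (+-suc k i))) e′ , imp′

    outcomeTM : Maybe (TMConfig M) → Status
    outcomeTM = outcome (λ C → TM.status M (TMConfig.state C))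

    outcomeFA : Maybe (FAConfig automaton) → Status
    outcomeFA = outcome (λ D → FA.status automaton (FAConfig.state D))

    -- After `i` Turing machine steps the automaton has a matching time `k` within `i` budgets. A
    -- breakdown is matched by the outcome `rejecting`, whether through `dead` or through a stuck
    -- input head.
    data Progress (i : ℕ) : Maybe (TMConfig M) → Set where
      alive : ∀ {C a D} k → 2 * k ≤ i * T → runFA automaton w k ≡ just D → Implements D a →
        Represents C a → Progress i (just C)
      rejected : ∀ k → 2 * k ≤ i * T → outcomeFA (runFA automaton w k) ≡ rejecting → Progress i nothing

    represents-status : ∀ {C a} → Represents C a → statusOf (Conf.state a) ≡ TM.status M (TMConfig.state C)
    represents-status (Simulation.near₀ _) = refl
    represents-status (Simulation.near₁ _) = refl
    represents-status (Simulation.far _ _) = refl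

    private
      budget : ∀ {i j k K} → 2 * k ≤ i * T → j ≤ K → 2 * K ≤ T → 2 * (j + k) ≤ suc i * T
      budget {i} {j} {k} le j≤K le′ = subst (_≤ suc i * T) (≡-sym (*-distribˡ-+ 2 j k))
        (+-mono-≤ (≤-trans (*-monoʳ-≤ 2 j≤K) le′) le)

      rest : ∀ {i C a D} k → 2 * k ≤ i * T → runFA automaton w k ≡ just D → Implements D a →
        Represents C a → TM.status M (TMConfig.state C) ≢ running → Progress (suc i) (stepTM M w C)
      rest {i} {C} k le e imp rep halted = subst (Progress (suc i)) (≡-sym (stepTM-halted M w C halted))
        (alive k (≤-trans le (m≤n+m (i * T) T)) e imp rep)

      advance : ∀ {i r a D} k → 2 * k ≤ i * T → runFA automaton w k ≡ just D → Implements D a →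
        Simulated r a → Progress (suc i) r
      advance {i} k le e imp (continues le′ r rep refl) with reach-implements k r e imp
      ... | j , j≤K , D′ , e′ , imp′ = alive (j + k) (budget {i} {j} {k} le j≤K le′) e′ imp′ rep
      advance {i} k le e imp (rejects le′ r rej refl) with reach-implements k r e imp
      ... | j , j≤K , D′ , e′ , imp′ = rejected (j + k) (budget {i} {j} {k} le j≤K le′)
        (trans (cong outcomeFA e′) (trans (status-implements {D′} imp′) rej))
      advance {i} k le e imp (sticks le′ r stuck refl) with reach-implements k r e imp
      ... | j , j≤K , D′ , e′ , imp′ = rejected (suc j + k) (budget {i} {suc j} {k} le (s≤s j≤K) le′)
        (cong outcomeFA (trans (cong (_>>= stepFA automaton w) e′) (stuck-implements {D′} imp′ stuck)))

      progress-step : ∀ {i C a D} k → 2 * k ≤ i * T → runFA automaton w k ≡ just D → Implements D a →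
        Represents C a → TMConfig.workPos C < L →
        ∀ st → TM.status M (TMConfig.state C) ≡ st → Progress (suc i) (stepTM M w C)
      progress-step {i} k le e imp rep space running st = advance {i} k le e imp (simulate rep space st)
      progress-step {i} k le e imp rep space accepting st =
        rest {i} k le e imp rep (λ r → accepting≢running (trans (≡-sym st) r))
      progress-step {i} k le e imp rep space rejecting st =
        rest {i} k le e imp rep (λ r → rejecting≢running (trans (≡-sym st) r))

    progress : (∀ i C → runTM M w i ≡ just C → TMConfig.workPos C < L) → ∀ i → Progress i (runTM M w i)
    progress space zero = alive 0 z≤n refl (refl , λ h → initial (splitAt c h))
      (Simulation.near₀ tracksHold-init)
      where
      initial : ∀ h →
        0 ≡ position (conf (near (TM.start M , TM.blank M , TM.blank M) false) 0 0 0 0 (replicate c 0)) h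
      initial (inj₁ k) = ≡-sym (lookup-replicate k 0)
      initial inputHead = refl
      initial xHead = refl
      initial yHead = refl
      initial uHead = refl
      initial idleHead = refl
    progress space (suc i) with runTM M w i in eq | progress space i
    ... | nothing | rejected k le rej = rejected k (≤-trans le (m≤n+m (i * T) T)) rej
    ... | just C | alive k le e imp rep = progress-step {i} k le e imp rep (space i C eq) _ refl

    simulation : (∀ i C → runTM M w i ≡ just C → TMConfig.workPos C < L) → ∀ i →
      ∃ λ k → 2 * k ≤ i * T × outcomeFA (runFA automaton w k) ≡ outcomeTM (runTM M w i)
    simulation space i with runTM M w i | progress space i
    ... | nothing | rejected k le rej = k , le , rej
    ... | just C | alive {D = D} k le e imp rep = k , le ,
      trans (cong outcomeFA e) (trans (status-implements {D} imp) (represents-status rep))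

    open Runs (λ D → FA.status automaton (FAConfig.state D)) (stepFA automaton w)
      (stepFA-halted automaton w) (runFA automaton w) (λ _ → refl) public
      renaming (outcome-unique to outcomeFA-unique)
      hiding (halted-run)

-- Time bound and equivalence of acceptance

theorem1 : (c : ℕ) → 0 < c → (t : ℕ → ℕ) → (m : ℕ) → (P : List (Fin m) → Set) →
    (∃ λ g → g ≤ 2 ^ c × Σ (TM m g) λ M →
    SpaceBoundTM M (λ n → ⌊log₂ (n + 2) ⌋) × TimeBoundTM M t × RecognizesTM M P) →
    Σ (FA (c + 5) m) λ A →
    TimeBoundFA A (λ n → (t n * ((4 * c + 3) * n + 4 * c + 4)) / 2) × RecognizesFA A P
theorem1 (suc c′) _ t m P (g , g≤2^c , M , space , time , recognizes) =
  automaton , timeBound , λ w →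
    (λ Pw → complete w (proj₁ (recognizes w) Pw)) , (λ acc → proj₂ (recognizes w) (sound w acc))
  where
  open Automaton {c′} M g≤2^c
  open Correctness

  halted⇒ : ∀ {w} r → HaltedTM M r → outcomeTM w r ≢ running
  halted⇒ nothing _ ()
  halted⇒ (just _) h = h

  ⇒halted : ∀ {w} r → outcomeFA w r ≢ running → HaltedFA automaton r
  ⇒halted nothing _ = tt
  ⇒halted (just _) h = h

  timeBound : TimeBoundFA automaton (λ n → (t n * ((4 * suc c′ + 3) * n + 4 * suc c′ + 4)) / 2)
  timeBound w with time w
  ... | i , i≤t , h with simulation w (space w) i
  ... | k , 2k≤ , e = k ,
    -- From 2 k ≤ i T ≤ t(n) T, division by 2 gives the bound, as `k * 2 / 2` is `k`.
    subst (_≤ _) (m*n/n≡m k 2)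
      (/-monoˡ-≤ 2 (≤-trans (≤-reflexive (*-comm k 2)) (≤-trans 2k≤ (*-monoˡ-≤ _ i≤t)))) ,
    ⇒halted {w} _ (λ r → halted⇒ {w} (runTM M w i) h (trans (≡-sym e) r))

  complete : ∀ w → AcceptsTM M w → AcceptsFA automaton w
  complete w (i , C , e , acc) with simulation w (space w) i
  ... | k , _ , e′ with runFA automaton w k in eq | trans e′ (trans (cong (outcomeTM w) e) acc)
  ... | just D | acc′ = k , D , eq , acc′

  -- The simulation leads only from Turing machine times to automaton times. So it is applied at a
  -- time when the Turing machine has halted; the automaton has then halted too, and uniqueness of
  -- its outcome transfers acceptance back.
  sound : ∀ w → AcceptsFA automaton w → AcceptsTM M w
  sound w (k , D , e , acc) with time w
  ... | i , _ , h with simulation w (space w) i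
  ... | j , _ , e′
    with accepted ← trans (≡-sym e′) (trans
           (outcomeFA-unique w j k (λ r → halted⇒ {w} (runTM M w i) h (trans (≡-sym e′) r))
             (λ r → accepting≢running (trans (≡-sym (trans (cong (outcomeFA w) e) acc)) r)))
           (trans (cong (outcomeFA w) e) acc))
    with runTM M w i in eq
  ... | just C = i , C , eq , accepted
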